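{- Let $p$ be a positive integer relatively prime to $h$. For $\widetilde{w}\in\widetilde{W}^{p}$, the stabilizer $\{u\in W:u\cdot\mathcal{A}(\widetilde{w})=\mathcal{A}(\widetilde{w})\}$ of $\mathcal{A}(\widetilde{w})\in Q^\vee/pQ^\vee$ in $W$ is generated by $\{s_\beta:\beta\in\widetilde{w}(\widetilde{\Phi}_p)\cap\Phi\}$.
   Context: Let $\Phi$ be an irreducible crystallographic root system of rank $r$ in a real Euclidean space $V$ with inner product $\langle\cdot,\cdot\rangle$, simple roots $\Delta$, positive roots $\Phi^+$, Weyl group $W$ (with reflections $s_\beta$), highest root $\theta$. Height of $\alpha=\sum a_i\alpha_i$ is $\sum a_i$, $\Phi_t$ = roots of height $t$, $h=1+\mathrm{ht}(\theta)$. The affine Weyl group is $\widetilde{W}=W\ltimes Q^\vee$ ($Q^\vee$ the coroot lattice), elements $wt_\mu$, $t_\mu(x)=x+\mu$, action on $V$ written $\widetilde{w}\cdot x$. $W$ acts on $Q^\vee/pQ^\vee$. $A_{\circ}=\{x:\langle x,\alpha\rangle>0\ \forall\alpha\in\Delta,\ \langle x,\theta\rangle<1\}$. Affine roots $\alpha+k\delta$, with $wt_\mu(\alpha+k\delta)=w(\alpha)+(k-\langle\mu,\alpha\rangle)\delta$; $\Phi$ is identified with $\{\alpha+0\delta\}$; $\widetilde{\Phi}^+=\{\alpha+k\delta:\alpha\in\Phi^+,k\geq0\}\cup\{\alpha+k\delta:\alpha\in-\Phi^+,k>0\}$; $\mathrm{ht}(\alpha+k\delta)=\mathrm{ht}(\alpha)+kh$;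 $\widetilde{\Phi}_p$ = affine roots of height $p$; $\widetilde{W}^p=\{\widetilde{w}:\widetilde{w}(\widetilde{\Phi}_p)\subseteq\widetilde{\Phi}^+\}$. With $p=ah+b$, $0<b<h$, $\mathcal{S}_\Phi^p=\{x:\langle x,\alpha\rangle>-a\ \forall\alpha\in\Phi_b,\ \langle x,\alpha\rangle<a+1\ \forall\alpha\in\Phi_{h-b}\}$, and $\widetilde{w}_p$ is the unique element of $\widetilde{W}$ with $\widetilde{w}_p(\mathcal{S}_\Phi^p)=pA_\circ$. The Anderson map is $\mathcal{A}(\widetilde{w})=\widetilde{w}\,\widetilde{w}_p^{ -1}\cdot0+pQ^\vee$ for $\widetilde{w}\in\widetilde{W}^p$. -}

module Defs where

open import Data.Nat as ℕ using (ℕ; zero; suc; _∸_)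
open import Data.Integer as ℤ using (ℤ; +_)
open import Data.Rational as ℚ using (ℚ)
open import Data.Fin using (Fin; zero; suc; _≟_)
open import Data.Bool using (Bool; if_then_else_)
open import Data.List using (List; []; _∷_; _++_; reverse; concatMap)
open import Data.List.Relation.Unary.All using (All)
open import Data.Product using (Σ; ∃; _×_; _,_; proj₁; proj₂)
open import Data.Sum using (_⊎_)
open import Relation.Binary.PropositionalEquality using (_≡_; _≢_)
open import Relation.Nullary using (¬_)
open import Relation.Nullary.Decidable using (⌊_⌋)

-- Coordinates.  A root system of rank r is given by its Cartan matrix
-- C i j = ⟨α_i^∨ , α_j⟩.  Elements of the root lattice Q are integer
-- vectors in the basis of simple roots; points of V (rational points)
-- are vectors in the basis of simple coroots α_i^∨; Q^∨ = integer
-- vectors in that basis.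

Vecℤ : ℕ → Set
Vecℤ r = Fin r → ℤ

Vecℚ : ℕ → Set
Vecℚ r = Fin r → ℚ

CartanMatrix : ℕ → Set
CartanMatrix r = Fin r → Fin r → ℤ

sumℤ : ∀ {r} → (Fin r → ℤ) → ℤ
sumℤ {zero} f = + 0
sumℤ {suc r} f = f zero ℤ.+ sumℤ (λ i → f (suc i))

sumℚ : ∀ {r} → (Fin r → ℚ) → ℚ
sumℚ {zero} f = ℚ.0ℚ
sumℚ {suc r} f = f zero ℚ.+ sumℚ (λ i → f (suc i))

toℚ : ℤ → ℚ
toℚ z = z ℚ./ 1

_≐_ : ∀ {A : Set} {r} → (Fin r → A) → (Fin r → A) → Set
f ≐ g = ∀ k → f k ≡ g k

unitℤ : ∀ {r} → Fin r → Vecℤ r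
unitℤ i k = if ⌊ k ≟ i ⌋ then + 1 else + 0

-- Irreducible crystallographic root systems = irreducible Cartan
-- matrices of finite type (symmetrizable with positive definite
-- symmetrization, indecomposable), rank ≥ 1.

record IsIrreducibleFiniteCartan {r} (C : CartanMatrix r) : Set where
  field
    rank-pos    : 1 ℕ.≤ r
    diag        : ∀ i → C i i ≡ + 2
    offdiag     : ∀ i j → i ≢ j → C i j ℤ.≤ + 0
    d           : Fin r → ℕ
    d-pos       : ∀ i → 1 ℕ.≤ d i
    symm        : ∀ i j → + d i ℤ.* C i j ≡ + d j ℤ.* C j i
    posdef      : ∀ (x : Vecℤ r) → ¬ (∀ i → x i ≡ + 0) →
                  + 0 ℤ.< sumℤ (λ i → sumℤ (λ j → x i ℤ.* + d i ℤ.* C i j ℤ.* x j))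
    irreducible : ∀ (S : Fin r → Bool) → (∀ i j → S i ≢ S j → C i j ≡ + 0) →
                  ∀ i j → S i ≡ S j

-- Pairings ⟨x , α⟩ (x in coroot coordinates, α in root coordinates)

pairℚ : ∀ {r} → CartanMatrix r → Vecℚ r → Vecℤ r → ℚ
pairℚ C x a = sumℚ (λ i → sumℚ (λ j → x i ℚ.* toℚ (C i j ℤ.* a j)))

pairℤ : ∀ {r} → CartanMatrix r → Vecℤ r → Vecℤ r → ℤ
pairℤ C μ a = sumℤ (λ i → sumℤ (λ j → μ i ℤ.* C i j ℤ.* a j))

-- Weyl group W: elements are words in the simple reflections
-- (the word i₁ ∷ i₂ ∷ … denotes s_{i₁} s_{i₂} …).

-- s_i on V (coroot coordinates): x ↦ x - ⟨x,α_i⟩ α_i^∨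
sRefV : ∀ {r} → CartanMatrix r → Fin r → Vecℚ r → Vecℚ r
sRefV C i x k = x k ℚ.- (if ⌊ k ≟ i ⌋ then pairℚ C x (unitℤ i) else ℚ.0ℚ)

-- s_i on Q (root coordinates): a ↦ a - ⟨α_i^∨,a⟩ α_i
sRefR : ∀ {r} → CartanMatrix r → Fin r → Vecℤ r → Vecℤ r
sRefR C i a k = a k ℤ.- (if ⌊ k ≟ i ⌋ then pairℤ C (unitℤ i) a else + 0)

actV : ∀ {r} → CartanMatrix r → List (Fin r) → Vecℚ r → Vecℚ r
actV C [] x = x
actV C (i ∷ w) x = sRefV C i (actV C w x)

actR : ∀ {r} → CartanMatrix r → List (Fin r) → Vecℤ r → Vecℤ r
actR C [] a = a
actR C (i ∷ w) a = sRefR C i (actR C w a)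

IsRoot : ∀ {r} → CartanMatrix r → Vecℤ r → Set
IsRoot C a = Σ (List _) λ w → Σ (Fin _) λ i → a ≐ actR C w (unitℤ i)

IsPosRoot : ∀ {r} → CartanMatrix r → Vecℤ r → Set
IsPosRoot C a = IsRoot C a × (∀ k → + 0 ℤ.≤ a k)

height : ∀ {r} → Vecℤ r → ℤ
height a = sumℤ a

negV : ∀ {r} → Vecℤ r → Vecℤ r
negV a k = ℤ.- a k

IsHighestRoot : ∀ {r} → CartanMatrix r → Vecℤ r → Set
IsHighestRoot C θ = IsRoot C θ × (∀ a → IsRoot C a → ∀ k → a k ℤ.≤ θ k)

-- Affine roots α + kδ, represented as pairs (α , k)

AffRoot : ℕ → Set
AffRoot r = Vecℤ r × ℤ

IsAffRoot : ∀ {r} → CartanMatrix r → AffRoot r → Set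
IsAffRoot C (a , k) = IsRoot C a

IsPosAffRoot : ∀ {r} → CartanMatrix r → AffRoot r → Set
IsPosAffRoot C (a , k) =
  (IsPosRoot C a × + 0 ℤ.≤ k) ⊎ (IsPosRoot C (negV a) × + 0 ℤ.< k)

affHeight : ∀ {r} → ℕ → AffRoot r → ℤ
affHeight h (a , k) = height a ℤ.+ k ℤ.* + h

InΦ̃ : ∀ {r} → CartanMatrix r → (h p : ℕ) → AffRoot r → Set
InΦ̃ C h p ar = IsAffRoot C ar × affHeight h ar ≡ + p

-- Affine Weyl group: w t_μ represented as (w , μ)

AffW : ℕ → Set
AffW r = List (Fin r) × Vecℤ r

actAff : ∀ {r} → CartanMatrix r → AffW r → AffRoot r → AffRoot r
actAff C (w , μ) (a , k) = actR C w a , k ℤ.- pairℤ C μ a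

InWp : ∀ {r} → CartanMatrix r → (h p : ℕ) → AffW r → Set
InWp C h p w̃ = ∀ ar → InΦ̃ C h p ar → IsPosAffRoot C (actAff C w̃ ar)

actPt : ∀ {r} → CartanMatrix r → AffW r → Vecℚ r → Vecℚ r
actPt C (w , μ) x = actV C w (λ k → x k ℚ.+ toℚ (μ k))

actPtInv : ∀ {r} → CartanMatrix r → AffW r → Vecℚ r → Vecℚ r
actPtInv C (w , μ) x k = actV C (reverse w) x k ℚ.- toℚ (μ k)

InpA : ∀ {r} → CartanMatrix r → Vecℤ r → ℕ → Vecℚ r → Set
InpA C θ p x = (∀ i → ℚ.0ℚ ℚ.< pairℚ C x (unitℤ i)) × (pairℚ C x θ ℚ.< toℚ (+ p))

-- 𝒮^p_Φ, where p = a h + b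
InS : ∀ {r} → CartanMatrix r → (h a b : ℕ) → Vecℚ r → Set
InS C h a b x =
  (∀ α → IsRoot C α → height α ≡ + b → toℚ (ℤ.- (+ a)) ℚ.< pairℚ C x α) ×
  (∀ α → IsRoot C α → height α ≡ + (h ∸ b) → pairℚ C x α ℚ.< toℚ (+ (a ℕ.+ 1)))

IsWp : ∀ {r} → CartanMatrix r → Vecℤ r → (h p a b : ℕ) → AffW r → Set
IsWp C θ h p a b w̃ = ∀ x →
  (InS C h a b x → InpA C θ p (actPt C w̃ x)) × (InpA C θ p (actPt C w̃ x) → InS C h a b x)

-- Anderson map  𝒜(w̃) = w̃ w̃_p⁻¹ · 0  (mod p Q^∨)

anderson : ∀ {r} → CartanMatrix r → (w̃p w̃ : AffW r) → Vecℚ r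
anderson C w̃p w̃ = actPt C w̃ (actPtInv C w̃p (λ _ → ℚ.0ℚ))

InStab : ∀ {r} → CartanMatrix r → ℕ → Vecℚ r → List (Fin r) → Set
InStab C p v u = Σ (Vecℤ _) λ ν → ∀ k → actV C u v k ℚ.- v k ≡ toℚ (+ p ℤ.* ν k)

RefSet : ∀ {r} → CartanMatrix r → (h p : ℕ) → AffW r → Vecℤ r → Set
RefSet C h p w̃ β = Σ (AffRoot _) λ ar →
  InΦ̃ C h p ar × (proj₁ (actAff C w̃ ar) ≐ β) × (proj₂ (actAff C w̃ ar) ≡ + 0)

-- the reflection s_{v(α_i)} = v s_i v⁻¹ as a word
reflWord : ∀ {r} → List (Fin r) → Fin r → List (Fin r)
reflWord v i = v ++ (i ∷ reverse v)

-- u lies in the subgroup of W generated by {s_β : R β}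
-- (reflections are involutions, so the subgroup is the set of finite
-- products of them; equality in W is equality of the action on V)
InGen : ∀ {r} → CartanMatrix r → (Vecℤ r → Set) → List (Fin r) → Set
InGen {r} C R u = Σ (List (List (Fin r) × Fin r)) λ gs →
  All (λ g → R (actR C (proj₁ g) (unitℤ (proj₂ g)))) gs ×
  (∀ x → actV C u x ≐ actV C (concatMap (λ g → reflWord (proj₁ g) (proj₂ g)) gs) x)

{-# OPTIONS --safe #-}
module Submission where

-- Write V ∈ Q^∨ for a representative of 𝒜(w̃).  The elements of W fixing V modulo p Q^∨ are, after
-- conjugation by the linear part of w̃ w̃_p⁻¹, the elements of W ⋉ p Q^∨ fixing a point y of the closed
-- alcove p A∘, because w̃ ∈ W̃^p means A∘ ⊆ w̃ w̃_p⁻¹ (p A∘).  Such an element u is treated by descent: let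
-- z = p ρ^∨ / h, the point at which all simple affine roots take the value p / h.  If u z lies beyond a
-- wall of p A∘, then y lies on that wall, and reflecting in it brings u z closer to z.  Otherwise the
-- values at u z of the simple affine roots are positive multiples of p / h with the same weighted sum as
-- at z, so u z = z.  Then the linear part of u fixes z - y, on which no root vanishes because p is prime
-- to h, so u = 1.
-- That w̃_p⁻¹ maps the walls of p A∘ to affine roots of height p is read off from w̃_p(S) = p A∘; since
-- height is linear, and again p is prime to h, the reflections s_β of the statement are exactly those in
-- the walls through y.

open import Defs

-- The group `W` is given by words, with neither reduced expressions nor finiteness of `Φ` at hand,
-- so what the descent needs is extracted from the integral form `B`. Signs of roots come from a
-- norm estimate, and both descents (of `u z` towards `z`, and of a regular vector into the dominant
-- chamber) terminate because a squared distance between lattice vectors is a nonnegative integer.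
-- This is why everything is kept integral: `z` and `ρ^∨` need not be lattice points, so `h (y - z)`
-- enters as the functional `f`, and a positive multiple of it as the lattice vector `ξ`. The affine
-- map attached to `u` fixes `y`, hence moves `z` exactly as its linear part moves `z - y`;
-- comparing `u ξ` with `ξ` therefore measures the distance from `u z` to `z` up to a constant
-- factor. Coprimality acts through heights, in both inclusions. If `f` vanished on a root, `h`
-- would divide its height, and some affine root would have height zero. Conversely, comparing
-- heights under `w̃_p` shows that `p` divides the pairing of `V` with every `β` of the statement,
-- so that `s_β` fixes `V` modulo `p`.

module Development where

  open import Data.Nat as ℕ using (ℕ; zero; suc)
  import Data.Nat.Properties as ℕ
  import Data.Nat.Divisibility as ℕ
  open import Data.Nat.Coprimality as Coprimality using (Coprime)
  open import Data.Integer hiding (suc; _≟_; pos; neg)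
  open import Data.Integer.Properties hiding (_≟_)
  open import Data.Integer.Divisibility.Signed using (∣ᵤ⇒∣; divides)
  open import Data.Integer.Tactic.RingSolver using (solve-∀)
  open import Data.Rational as ℚ using (ℚ; mkℚ; 0ℚ; 1ℚ; 1/_)
  import Data.Rational.Properties as ℚ
  open import Data.Rational.Unnormalised as ℚᵘ using (mkℚᵘ; *≡*; *<*)
  import Data.Rational.Unnormalised.Properties as ℚᵘ
  open import Data.Fin using (Fin; zero; suc; _≟_)
  open import Data.Fin.Properties using (all?; any?)
  open import Data.List using (List; []; _∷_; _++_; reverse; length; concatMap; initLast; _∷ʳ′_)
  import Data.List.Properties as List
  open import Data.List.Relation.Unary.All using (All; []; _∷_)
  open import Data.Product using (Σ; _×_; _,_; proj₁; proj₂)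
  open import Data.Sum using (_⊎_; inj₁; inj₂)
  open import Data.Empty using (⊥-elim)
  open import Relation.Binary.Definitions using (tri<; tri≈; tri>)
  open import Relation.Binary.PropositionalEquality hiding (resp)
  open import Relation.Nullary using (¬_; yes; no)
  open import Function using (_∘_)

  -- Integer inequalities, sums and linear functionals

  0≤-+ : ∀ {x y} → + 0 ≤ x → + 0 ≤ y → + 0 ≤ x + y
  0≤-+ = +-mono-≤

  0≤-* : ∀ {x y} → + 0 ≤ x → + 0 ≤ y → + 0 ≤ x * y
  0≤-* {x} {y} p q = subst (_≤ x * y) (*-zeroʳ x) (*-monoˡ-≤-nonNeg x {{nonNegative p}} q)

  0<-* : ∀ {x y} → + 0 < x → + 0 < y → + 0 < x * y
  0<-* {x} {y} p q = subst (_< x * y) (*-zeroʳ x) (*-monoˡ-<-pos x {{positive p}} q)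

  ≤-by : ∀ {x y e} → + 0 ≤ e → e ≡ y - x → x ≤ y
  ≤-by p refl = 0≤i-j⇒j≤i p

  <-by : ∀ {x y e} → + 0 < e → e ≡ y - x → x < y
  <-by {x} {y} p refl = subst₂ _<_ (+-identityˡ x) (lem x y) (+-monoˡ-< x p)
    where
    lem : ∀ x y → y - x + x ≡ y
    lem = solve-∀

  0≤-diff : ∀ {x y} → x ≤ y → + 0 ≤ y - x
  0≤-diff = i≤j⇒0≤j-i

  0<⇒1≤ : ∀ {x} → + 0 < x → + 1 ≤ x
  0<⇒1≤ = i<j⇒suc[i]≤j

  1≤⇒0< : ∀ {x} → + 1 ≤ x → + 0 < x
  1≤⇒0< = suc[i]≤j⇒i<j

  0<-diff : ∀ {x y} → x < y → + 0 < y - x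
  0<-diff {x} {y} p = subst (_< y - x) (+-inverseʳ x) (+-monoˡ-< (- x) p)

  0<-cancel-* : ∀ {c x} → + 0 < c → + 0 < c * x → + 0 < x
  0<-cancel-* {c} {x} p q =
    *-cancelˡ-<-nonNeg c {{nonNegative (<⇒≤ p)}} (subst (_< c * x) (sym (*-zeroʳ c)) q)

  *-cancelˡ-pos : ∀ {c x y} → + 0 < c → c * x ≡ c * y → x ≡ y
  *-cancelˡ-pos {c} {x} {y} p = *-cancelˡ-≡ c x y {{>-nonZero p}}

  sum-cong : ∀ {r} {f g : Vecℤ r} → f ≐ g → sumℤ f ≡ sumℤ g
  sum-cong {zero} p = refl
  sum-cong {suc r} p = cong₂ _+_ (p zero) (sum-cong (p ∘ suc))

  interchange : ∀ a b c d → (a + b) + (c + d) ≡ (a + c) + (b + d)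
  interchange = solve-∀

  sum-+ : ∀ {r} (f g : Vecℤ r) → sumℤ (λ i → f i + g i) ≡ sumℤ f + sumℤ g
  sum-+ {zero} f g = refl
  sum-+ {suc r} f g = trans (cong (_+_ (f zero + g zero)) (sum-+ (f ∘ suc) (g ∘ suc)))
    (interchange (f zero) (g zero) _ _)

  sum-* : ∀ {r} c (f : Vecℤ r) → sumℤ (λ i → c * f i) ≡ c * sumℤ f
  sum-* {zero} c f = sym (*-zeroʳ c)
  sum-* {suc r} c f = trans (cong (_+_ (c * f zero)) (sum-* c (f ∘ suc)))
    (sym (*-distribˡ-+ c (f zero) _))

  sum-0 : ∀ {r} → sumℤ {r} (λ _ → + 0) ≡ + 0
  sum-0 {zero} = refl
  sum-0 {suc r} = trans (+-identityˡ _) (sum-0 {r})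

  sum-nonneg : ∀ {r} {f : Vecℤ r} → (∀ i → + 0 ≤ f i) → + 0 ≤ sumℤ f
  sum-nonneg {zero} p = ≤-refl
  sum-nonneg {suc r} p = 0≤-+ (p zero) (sum-nonneg (p ∘ suc))

  sum-nonneg-0 : ∀ {r} {f : Vecℤ r} → (∀ i → + 0 ≤ f i) → sumℤ f ≤ + 0 → ∀ i → f i ≡ + 0
  sum-nonneg-0 {suc r} {f} p q zero = ≤-antisym
    (≤-trans (≤-by (sum-nonneg (p ∘ suc)) (lem (f zero) _)) q) (p zero)
    where
    lem : ∀ x s → s ≡ x + s - x
    lem = solve-∀
  sum-nonneg-0 {suc r} {f} p q (suc i) = sum-nonneg-0 (p ∘ suc)
    (≤-trans (≤-by (p zero) (lem (f zero) _)) q) i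
    where
    lem : ∀ x s → x ≡ x + s - s
    lem = solve-∀

  sum-mono : ∀ {r} {f g : Vecℤ r} → (∀ i → f i ≤ g i) → sumℤ f ≤ sumℤ g
  sum-mono {zero} p = ≤-refl
  sum-mono {suc r} p = +-mono-≤ (p zero) (sum-mono (p ∘ suc))

  sum-nonpos : ∀ {r} {f : Vecℤ r} → (∀ i → f i ≤ + 0) → sumℤ f ≤ + 0
  sum-nonpos {zero} p = ≤-refl
  sum-nonpos {suc r} p = +-mono-≤ (p zero) (sum-nonpos (p ∘ suc))

  infixl 6 _⊕_
  infixl 7 _⊙_

  _⊕_ : ∀ {r} → Vecℤ r → Vecℤ r → Vecℤ r
  (a ⊕ b) k = a k + b k

  _⊙_ : ∀ {r} → ℤ → Vecℤ r → Vecℤ r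
  (c ⊙ a) k = c * a k

  unit-suc : ∀ {r} (i k : Fin r) → unitℤ (suc i) (suc k) ≡ unitℤ i k
  unit-suc i k with k ≟ i
  ... | yes _ = refl
  ... | no  _ = refl

  unit-same : ∀ {r} (i : Fin r) → unitℤ i i ≡ + 1
  unit-same i with i ≟ i
  ... | yes _ = refl
  ... | no i≢i = ⊥-elim (i≢i refl)

  -- Vectors are functions compared pointwise, so compatibility with `_≐_` is a field of its own.
  -- Identities between functionals are checked on `unitℤ` by `linear-ext`; linear maps are handled
  -- through their compositions with functionals.
  record Linear {r} (f : Vecℤ r → ℤ) : Set where
    constructor linear
    field
      resp-≐ : ∀ {a b} → a ≐ b → f a ≡ f b
      add  : ∀ a b → f (a ⊕ b) ≡ f a + f b
      scl  : ∀ c a → f (c ⊙ a) ≡ c * f a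

  open Linear

  cons : ∀ {r} → ℤ → Vecℤ r → Vecℤ (suc r)
  cons x a zero = x
  cons x a (suc k) = a k

  linear-expand : ∀ {r} {f : Vecℤ r → ℤ} → Linear f → ∀ a → f a ≡ sumℤ (λ i → a i * f (unitℤ i))
  linear-expand {zero} {f} L a = trans (resp-≐ L {b = + 0 ⊙ a} (λ ())) (scl L (+ 0) a)
  linear-expand {suc r} {f} L a =
    trans (resp-≐ L split) (trans (add L _ _) (cong₂ _+_ (scl L (a zero) (unitℤ zero))
      (trans (linear-expand tailL (a ∘ suc))
        (sum-cong (λ i → cong (a (suc i) *_) (resp-≐ L (λ { zero → refl ; (suc k) → sym (unit-suc i k) })))))))
    where
    split : a ≐ (a zero ⊙ unitℤ zero ⊕ cons (+ 0) (a ∘ suc))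
    split zero = sym (trans (+-identityʳ _) (*-identityʳ _))
    split (suc k) = sym (trans (cong (_+ a (suc k)) (*-zeroʳ (a zero))) (+-identityˡ _))
    tailL : Linear (f ∘ cons (+ 0))
    tailL .resp-≐ p = resp-≐ L (λ { zero → refl ; (suc k) → p k })
    tailL .add b c = trans (resp-≐ L (λ { zero → refl ; (suc k) → refl })) (add L _ _)
    tailL .scl x b = trans (resp-≐ L (λ { zero → sym (*-zeroʳ x) ; (suc k) → refl })) (scl L x _)

  linear-ext : ∀ {r} {f g : Vecℤ r → ℤ} → Linear f → Linear g →
    (∀ i → f (unitℤ i) ≡ g (unitℤ i)) → ∀ a → f a ≡ g a
  linear-ext F G p a = trans (linear-expand F a)
    (trans (sum-cong (λ i → cong (a i *_) (p i))) (sym (linear-expand G a)))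

  linear-sub : ∀ {r} {f : Vecℤ r → ℤ} → Linear f → ∀ a c b → f (a ⊕ (- c) ⊙ b) ≡ f a - c * f b
  linear-sub {f = f} L a c b = trans (add L a _)
    (cong (_+_ (f a)) (trans (scl L (- c) b) (sym (neg-distribˡ-* c (f b)))))

  linear-neg : ∀ {r} {f : Vecℤ r → ℤ} → Linear f → ∀ a → f (negV a) ≡ - f a
  linear-neg {f = f} L a = trans (resp-≐ L (λ k → sym (-1*i≡-i (a k)))) (trans (scl L -1ℤ a) (-1*i≡-i (f a)))

  linear-nonneg : ∀ {r} {f : Vecℤ r → ℤ} → Linear f → (∀ i → + 0 ≤ f (unitℤ i)) →
    ∀ {a} → (∀ k → + 0 ≤ a k) → + 0 ≤ f a
  linear-nonneg L p {a} q = subst (+ 0 ≤_) (sym (linear-expand L a)) (sum-nonneg (λ i → 0≤-* (q i) (p i)))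

  linear-mono : ∀ {r} {f : Vecℤ r → ℤ} → Linear f → (∀ i → + 0 ≤ f (unitℤ i)) →
    ∀ {a b} → (∀ k → a k ≤ b k) → f a ≤ f b
  linear-mono {f = f} L p {a} {b} q = ≤-by
    (linear-nonneg L p {b ⊕ -1ℤ ⊙ a} (λ k → subst (+ 0 ≤_) (cong (_+_ (b k)) (sym (-1*i≡-i (a k)))) (0≤-diff (q k))))
    (trans (linear-sub L b (+ 1) a) (cong (λ t → f b - t) (*-identityˡ (f a))))

  linear-comb : ∀ {r} {f g : Vecℤ r → ℤ} → Linear f → Linear g → ∀ c d → Linear (λ a → c * f a + d * g a)
  linear-comb F G c d .resp-≐ p = cong₂ (λ x y → c * x + d * y) (resp-≐ F p) (resp-≐ G p)
  linear-comb {f = f} {g} F G c d .add a b =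
    trans (cong₂ (λ x y → c * x + d * y) (add F a b) (add G a b)) (lem c d (f a) (f b) (g a) (g b))
    where
    lem : ∀ c d x y z w → c * (x + y) + d * (z + w) ≡ (c * x + d * z) + (c * y + d * w)
    lem = solve-∀
  linear-comb {f = f} {g} F G c d .scl e a =
    trans (cong₂ (λ x y → c * x + d * y) (scl F e a) (scl G e a)) (lem c d e (f a) (g a))
    where
    lem : ∀ c d e x y → c * (e * x) + d * (e * y) ≡ e * (c * x + d * y)
    lem = solve-∀

  height-linear : ∀ {r} → Linear (height {r})
  height-linear = linear sum-cong sum-+ sum-*

  height-unit : ∀ {r} (i : Fin r) → height (unitℤ i) ≡ + 1
  height-unit {suc r} zero = cong (_+_ (+ 1)) (sum-0 {r})
  height-unit {suc r} (suc i) = trans (+-identityˡ _)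
    (trans (sum-cong (unit-suc i)) (height-unit i))

  coord-linear : ∀ {r} (k : Fin r) → Linear (λ a → a k)
  coord-linear k = linear (λ p → p k) (λ _ _ → refl) (λ _ _ → refl)

  pair-linearʳ : ∀ {r} (C : CartanMatrix r) μ → Linear (pairℤ C μ)
  pair-linearʳ C μ .resp-≐ p = sum-cong (λ i → sum-cong (λ j → cong ((μ i * C i j) *_) (p j)))
  pair-linearʳ C μ .add a b =
    trans (sum-cong (λ i → trans (sum-cong (λ j → *-distribˡ-+ (μ i * C i j) (a j) (b j)))
                                 (sum-+ (λ j → μ i * C i j * a j) _))) (sum-+ (λ i → sumℤ (λ j → μ i * C i j * a j)) _)
  pair-linearʳ C μ .scl c a =
    trans (sum-cong (λ i → trans (sum-cong (λ j → lem (μ i * C i j) c (a j))) (sum-* c (λ j → μ i * C i j * a j)))) (sum-* c (λ i → sumℤ (λ j → μ i * C i j * a j)))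
    where
    lem : ∀ m c x → m * (c * x) ≡ c * (m * x)
    lem = solve-∀

  pair-linearˡ : ∀ {r} (C : CartanMatrix r) a → Linear (λ μ → pairℤ C μ a)
  pair-linearˡ C a .resp-≐ p = sum-cong (λ i → sum-cong (λ j → cong (λ m → m * C i j * a j) (p i)))
  pair-linearˡ C a .add μ ν =
    trans (sum-cong (λ i → trans (sum-cong (λ j → lem (μ i) (ν i) (C i j) (a j)))
                                 (sum-+ (λ j → μ i * C i j * a j) _))) (sum-+ (λ i → sumℤ (λ j → μ i * C i j * a j)) _)
    where
    lem : ∀ m n c x → (m + n) * c * x ≡ m * c * x + n * c * x
    lem = solve-∀
  pair-linearˡ C a .scl c μ =
    trans (sum-cong (λ i → trans (sum-cong (λ j → lem c (μ i) (C i j) (a j))) (sum-* c (λ j → μ i * C i j * a j)))) (sum-* c (λ i → sumℤ (λ j → μ i * C i j * a j)))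
    where
    lem : ∀ c m n x → c * m * n * x ≡ c * (m * n * x)
    lem = solve-∀

  sum-unit : ∀ {r} (i : Fin r) (f : Vecℤ r) → sumℤ (λ k → unitℤ i k * f k) ≡ f i
  sum-unit {suc r} zero f = trans (cong₂ _+_ (*-identityˡ (f zero)) (sum-0 {r})) (+-identityʳ _)
  sum-unit {suc r} (suc i) f = trans (+-identityˡ _)
    (trans (sum-cong (λ k → cong (_* f (suc k)) (unit-suc i k))) (sum-unit i (f ∘ suc)))

  pair-unitˡ : ∀ {r} (C : CartanMatrix r) i a → pairℤ C (unitℤ i) a ≡ sumℤ (λ j → C i j * a j)
  pair-unitˡ C i a = trans
    (sum-cong (λ l → trans (sum-cong (λ j → *-assoc (unitℤ i l) (C l j) (a j))) (sum-* (unitℤ i l) (λ j → C l j * a j))))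
    (sum-unit i (λ l → sumℤ (λ j → C l j * a j)))

  pair-unit : ∀ {r} (C : CartanMatrix r) i j → pairℤ C (unitℤ i) (unitℤ j) ≡ C i j
  pair-unit C i j = trans (pair-unitˡ C i (unitℤ j))
    (trans (sum-cong (λ l → *-comm (C i l) (unitℤ j l))) (sum-unit j (C i)))

  -- The Weyl group action; positive definite systems

  infixr 8 _ᵀ
  _ᵀ : ∀ {r} → CartanMatrix r → CartanMatrix r
  (C ᵀ) i j = C j i

  pair-ᵀ : ∀ {r} (C : CartanMatrix r) a b → pairℤ (C ᵀ) a b ≡ pairℤ C b a
  pair-ᵀ C a b = linear-ext (pair-linearˡ (C ᵀ) b) (pair-linearʳ C b)
    (λ i → linear-ext (pair-linearʳ (C ᵀ) (unitℤ i)) (pair-linearˡ C (unitℤ i))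
      (λ j → trans (pair-unit (C ᵀ) i j) (sym (pair-unit C j i))) b) a

  linear-≗ : ∀ {r} {f g : Vecℤ r → ℤ} → (∀ a → f a ≡ g a) → Linear g → Linear f
  linear-≗ p G .resp-≐ q = trans (p _) (trans (resp-≐ G q) (sym (p _)))
  linear-≗ p G .add a b = trans (p _) (trans (add G a b) (sym (cong₂ _+_ (p a) (p b))))
  linear-≗ p G .scl c a = trans (p _) (trans (scl G c a) (sym (cong (c *_) (p a))))

  module Action {r} (C : CartanMatrix r) where

    simple-≐ : ∀ i a → sRefR C i a ≐ (a ⊕ (- pairℤ C (unitℤ i) a) ⊙ unitℤ i)
    simple-≐ i a k with k ≟ i
    ... | yes _ = cong (_+_ (a k)) (sym (*-identityʳ (- pairℤ C (unitℤ i) a)))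
    ... | no  _ = cong (_+_ (a k)) (sym (*-zeroʳ (- pairℤ C (unitℤ i) a)))

    simple-apply : ∀ {f} → Linear f → ∀ i a →
      f (sRefR C i a) ≡ f a - pairℤ C (unitℤ i) a * f (unitℤ i)
    simple-apply L i a = trans (resp-≐ L (simple-≐ i a)) (linear-sub L a (pairℤ C (unitℤ i) a) (unitℤ i))

    simple-linear : ∀ {f} → Linear f → ∀ i → Linear (f ∘ sRefR C i)
    simple-linear {f} L i = linear-≗
      (λ a → trans (simple-apply L i a) (lem (f a) (pairℤ C (unitℤ i) a) (f (unitℤ i))))
      (linear-comb L (pair-linearʳ C (unitℤ i)) (+ 1) (- f (unitℤ i)))
      where
      lem : ∀ x y z → x - y * z ≡ + 1 * x + - z * y
      lem = solve-∀

    act-linear : ∀ {f} → Linear f → ∀ w → Linear (f ∘ actR C w)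
    act-linear L [] = L
    act-linear L (i ∷ w) = act-linear (simple-linear L i) w

    act-cong : ∀ w {a b} → a ≐ b → actR C w a ≐ actR C w b
    act-cong w p k = resp-≐ (act-linear (coord-linear k) w) p

    act-++ : ∀ w v a → actR C (w ++ v) a ≡ actR C w (actR C v a)
    act-++ [] v a = refl
    act-++ (i ∷ w) v a = cong (sRefR C i) (act-++ w v a)

    act-neg : ∀ w a → actR C w (negV a) ≐ negV (actR C w a)
    act-neg w a k = linear-neg (act-linear (coord-linear k) w) a

    module Involutive (diag : ∀ i → C i i ≡ + 2) where

      simple-unit : ∀ i → sRefR C i (unitℤ i) ≐ negV (unitℤ i)
      simple-unit i k = trans (simple-apply (coord-linear k) i (unitℤ i))
        (trans (cong (λ c → unitℤ i k - c * unitℤ i k) (trans (pair-unit C i i) (diag i))) (lem (unitℤ i k)))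
        where
        lem : ∀ x → x - + 2 * x ≡ - x
        lem = solve-∀

      simple-involutive : ∀ i a → sRefR C i (sRefR C i a) ≐ a
      simple-involutive i a k = trans (simple-apply (simple-linear (coord-linear k) i) i a)
        (trans (cong₂ (λ x y → x - pairℤ C (unitℤ i) a * y) (simple-apply (coord-linear k) i a) (simple-unit i k))
          (lem (a k) (pairℤ C (unitℤ i) a) (unitℤ i k)))
        where
        lem : ∀ x c u → x - c * u - c * - u ≡ x
        lem = solve-∀

      act-reverse : ∀ w a → actR C (reverse w) (actR C w a) ≐ a
      act-reverse [] a k = refl
      act-reverse (i ∷ w) a k = trans
        (cong (λ v → actR C v (sRefR C i (actR C w a)) k) (List.unfold-reverse i w))
        (trans (cong (λ x → x k) (act-++ (reverse w) (i ∷ []) (sRefR C i (actR C w a))))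
          (trans (act-cong (reverse w) (simple-involutive i (actR C w a)) k) (act-reverse w a k)))

      act-reverse′ : ∀ w a → actR C w (actR C (reverse w) a) ≐ a
      act-reverse′ w a k = trans (cong (λ v → actR C v (actR C (reverse w) a) k) (sym (List.reverse-involutive w)))
        (act-reverse (reverse w) a k)

      -- For `β = v α_i` the coefficient is `⟨β^∨, a⟩`, moved back to `α_i^∨` by invariance, so that
      -- no coroot of `β` has to be defined.
      reflection-apply : ∀ {f} → Linear f → ∀ v i a →
        f (actR C (reflWord v i) a) ≡ f a - pairℤ C (unitℤ i) (actR C (reverse v) a) * f (actR C v (unitℤ i))
      reflection-apply {f} L v i a = trans (cong f (act-++ v (i ∷ reverse v) a))
        (trans (simple-apply (act-linear L v) i (actR C (reverse v) a))
          (cong (λ x → x - pairℤ C (unitℤ i) (actR C (reverse v) a) * f (actR C v (unitℤ i)))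
            (resp-≐ L (act-reverse′ v a))))

  -- The action of W on the coroot lattice is its action on the root lattice of the transposed Cartan matrix.
  pair-act : ∀ {r} (C : CartanMatrix r) w y a →
    pairℤ C (actR (C ᵀ) w y) a ≡ pairℤ C y (actR C (reverse w) a)
  pair-act C [] y a = refl
  pair-act C (i ∷ w) y a =
    trans (Action.simple-apply (C ᵀ) (pair-linearˡ C a) i (actR (C ᵀ) w y))
    (trans (cong (λ c → pairℤ C (actR (C ᵀ) w y) a - c * pairℤ C (unitℤ i) a) (pair-ᵀ C (unitℤ i) (actR (C ᵀ) w y)))
    (trans (cong (λ t → pairℤ C (actR (C ᵀ) w y) a - t) (*-comm (pairℤ C (actR (C ᵀ) w y) (unitℤ i)) (pairℤ C (unitℤ i) a)))
    (trans (sym (Action.simple-apply C (pair-linearʳ C (actR (C ᵀ) w y)) i a))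
    (trans (pair-act C w y (sRefR C i a))
      (cong (pairℤ C y) (trans (sym (Action.act-++ C (reverse w) (i ∷ []) a))
        (cong (λ v → actR C v a) (sym (List.unfold-reverse i w)))))))))

  -- Integral solutions of positive definite linear systems

  dot : ∀ {n} → Vecℤ n → Vecℤ n → ℤ
  dot v x = sumℤ (λ i → v i * x i)

  dot-linear : ∀ {n} (v : Vecℤ n) → Linear (dot v)
  dot-linear v .resp-≐ p = sum-cong (λ i → cong (v i *_) (p i))
  dot-linear v .add a b = trans (sum-cong (λ i → *-distribˡ-+ (v i) (a i) (b i))) (sum-+ (λ i → v i * a i) _)
  dot-linear v .scl c a = trans (sum-cong (λ i → lem (v i) c (a i))) (sum-* c (λ i → v i * a i))
    where
    lem : ∀ v c a → v * (c * a) ≡ c * (v * a)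
    lem = solve-∀

  dot-unit : ∀ {n} (v : Vecℤ n) j → dot v (unitℤ j) ≡ v j
  dot-unit v j = trans (sum-cong (λ i → *-comm (v i) (unitℤ j i))) (sum-unit j v)

  rank-one-update : ∀ {n} (A : CartanMatrix n) m v x y →
    pairℤ (λ i j → m * A i j - v i * v j) x y ≡ m * pairℤ A x y - dot v x * dot v y
  rank-one-update A m v x y =
    trans (sum-cong (λ i → trans
      (sum-cong (λ j → lem (x i) (v i) (A i j) (v j) (y j)))
      (trans (sum-+ (λ j → m * (x i * A i j * y j)) _)
        (cong₂ _+_ (sum-* m (λ j → x i * A i j * y j)) (sum-* (- (v i * x i)) (λ j → v j * y j))))))
    (trans (sum-+ (λ i → m * sumℤ (λ j → x i * A i j * y j)) _)
      (cong₂ _+_ (sum-* m (λ i → sumℤ (λ j → x i * A i j * y j)))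
        (trans (sum-cong (λ i → lem′ (v i * x i) (dot v y)))
          (trans (sum-* (- dot v y) (λ i → v i * x i)) (lem″ (dot v y) (dot v x))))))
    where
    lem : ∀ x v a w y → x * (m * a - v * w) * y ≡ m * (x * a * y) + - (v * x) * (w * y)
    lem = lemm m
      where
      lemm : ∀ m x v a w y → x * (m * a - v * w) * y ≡ m * (x * a * y) + - (v * x) * (w * y)
      lemm = solve-∀
    lem′ : ∀ s t → - s * t ≡ - t * s
    lem′ = solve-∀
    lem″ : ∀ t s → - t * s ≡ - (s * t)
    lem″ = solve-∀

  pair-block : ∀ {n} (M : CartanMatrix (suc n)) → (∀ i j → M i j ≡ M j i) → ∀ x₀ x y₀ y →
    pairℤ M (cons x₀ x) (cons y₀ y) ≡
    (x₀ * M zero zero * y₀ + x₀ * dot (M zero ∘ suc) y) +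
    (dot (M zero ∘ suc) x * y₀ + pairℤ (λ i j → M (suc i) (suc j)) x y)
  pair-block M M-sym x₀ x y₀ y = cong₂ _+_
    (cong (_+_ (x₀ * M zero zero * y₀))
      (trans (sum-cong (λ j → *-assoc x₀ (M zero (suc j)) (y j))) (sum-* x₀ (λ j → M zero (suc j) * y j))))
    (trans (sum-+ (λ i → x i * M (suc i) zero * y₀) _)
      (cong (_+ pairℤ (λ i j → M (suc i) (suc j)) x y)
        (trans (sum-cong (λ i → trans (cong (λ t → x i * t * y₀) (M-sym (suc i) zero)) (lem (x i) (M zero (suc i)) y₀)))
          (trans (sum-* y₀ (λ i → M zero (suc i) * x i)) (*-comm y₀ _)))))
    where
    lem : ∀ x m y → x * m * y ≡ y * (m * x)
    lem = solve-∀

  -- The step replaces M by its Schur complement, scaled by the pivot to stay integral.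
  solve-posdef : ∀ {n} (M : CartanMatrix n) → (∀ i j → M i j ≡ M j i) →
    (∀ x → ¬ (∀ i → x i ≡ + 0) → + 0 < pairℤ M x x) →
    ∀ (e : Vecℤ n) → Σ (Vecℤ n) λ z → Σ ℤ λ K → (+ 0 < K) × (∀ j → pairℤ M z (unitℤ j) ≡ K * e j)
  solve-posdef {zero} M M-sym M-pos e = (λ ()) , + 1 , +<+ (ℕ.s≤s ℕ.z≤n) , λ ()
  solve-posdef {suc n} M M-sym M-pos e =
    -- The factor `m` clears the pivot, and the zeroth coordinate is then forced by the zeroth row,
    -- `m z₀ + v · (m z) = m K e₀`.
    cons (K * e zero - dot v z) (m ⊙ z) , m * K , 0<-* m>0 K>0 , solves
    where
    m : ℤ
    m = M zero zero
    v : Vecℤ n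
    v j = M zero (suc j)
    A N : CartanMatrix n
    A i j = M (suc i) (suc j)
    N i j = m * A i j - v i * v j
    N-sym : ∀ i j → N i j ≡ N j i
    N-sym i j = cong₂ (λ x y → m * x - y) (M-sym (suc i) (suc j)) (*-comm (v i) (v j))
    m>0 : + 0 < m
    m>0 = subst (+ 0 <_) (pair-unit M zero zero) (M-pos (unitℤ zero) (λ p → 1≢0 (p zero)))
      where
      1≢0 : + 1 ≢ + 0
      1≢0 ()
    N-pos : ∀ x → ¬ (∀ i → x i ≡ + 0) → + 0 < pairℤ N x x
    N-pos x x≢0 = 0<-cancel-* m>0 (subst (+ 0 <_) value (M-pos X X≢0))
      where
      s : ℤ
      s = dot v x
      -- The first coordinate makes the zeroth row of `M X` vanish, so the form of `M` at `X`
      -- reduces to `m` times the form of `N` at `x`.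
      X : Vecℤ (suc n)
      X = cons (- s) (m ⊙ x)
      X≢0 : ¬ (∀ i → X i ≡ + 0)
      X≢0 p = x≢0 (λ i → *-cancelˡ-pos m>0 (trans (p (suc i)) (sym (*-zeroʳ m))))
      lem : ∀ m s P → (- s * m * - s + - s * (m * s)) + (m * s * - s + m * (m * P)) ≡ m * (m * P - s * s)
      lem = solve-∀
      value : pairℤ M X X ≡ m * pairℤ N x x
      value = trans (pair-block M M-sym (- s) (m ⊙ x) (- s) (m ⊙ x))
        (trans (cong₂ (λ t P → (- s * m * - s + - s * t) + (t * - s + P)) (scl (dot-linear v) m x)
            (trans (scl (pair-linearˡ A (m ⊙ x)) m x) (cong (m *_) (scl (pair-linearʳ A x) m x))))
          (trans (lem m s (pairℤ A x x)) (cong (m *_) (sym (rank-one-update A m v x x)))))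
    e′ : Vecℤ n
    e′ j = m * e (suc j) - e zero * v j
    rec : Σ (Vecℤ n) λ z → Σ ℤ λ K → (+ 0 < K) × (∀ j → pairℤ N z (unitℤ j) ≡ K * e′ j)
    rec = solve-posdef N N-sym N-pos e′
    z : Vecℤ n
    z = proj₁ rec
    K : ℤ
    K = proj₁ (proj₂ rec)
    K>0 : + 0 < K
    K>0 = proj₁ (proj₂ (proj₂ rec))
    z₀ : ℤ
    z₀ = K * e zero - dot v z
    solves : ∀ j → pairℤ M (cons z₀ (m ⊙ z)) (unitℤ j) ≡ m * K * e j
    solves zero = trans (resp-≐ (pair-linearʳ M (cons z₀ (m ⊙ z))) {unitℤ zero} {cons (+ 1) (λ _ → + 0)} (λ { zero → refl ; (suc k) → refl }))
      (trans (pair-block M M-sym z₀ (m ⊙ z) (+ 1) (λ _ → + 0))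
      (trans (cong₂ (λ a b → (z₀ * m * + 1 + z₀ * a) + b) (trans (scl (dot-linear v) (+ 0) (λ _ → + 0)) refl)
         (cong₂ (λ a b → a * + 1 + b) (scl (dot-linear v) m z) (trans (scl (pair-linearʳ A (m ⊙ z)) (+ 0) (λ _ → + 0)) refl)))
       (lem m K (e zero) (dot v z))))
      where
      lem : ∀ m K e t → ((K * e - t) * m * + 1 + (K * e - t) * + 0) + (m * t * + 1 + + 0) ≡ m * K * e
      lem = solve-∀
    solves (suc j) = trans (resp-≐ (pair-linearʳ M (cons z₀ (m ⊙ z))) {unitℤ (suc j)} {cons (+ 0) (unitℤ j)} (λ { zero → refl ; (suc k) → unit-suc j k }))
      (trans (pair-block M M-sym z₀ (m ⊙ z) (+ 0) (unitℤ j))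
      (trans (cong₂ (λ a b → (z₀ * m * + 0 + z₀ * a) + (dot v (m ⊙ z) * + 0 + b)) (dot-unit v j)
        (trans (scl (pair-linearˡ A (unitℤ j)) m z) mP))
        (trans (lem m K (e zero) (e (suc j)) (dot v z) (v j) (dot v (m ⊙ z))) refl)))
      where
      add-sub : ∀ x t → x ≡ x - t + t
      add-sub = solve-∀
      mP : m * pairℤ A z (unitℤ j) ≡ K * e′ j + dot v z * v j
      mP = trans (add-sub _ (dot v z * v j)) (cong (_+ dot v z * v j)
        (trans (cong (λ t → m * pairℤ A z (unitℤ j) - dot v z * t) (sym (dot-unit v j)))
        (trans (sym (rank-one-update A m v z (unitℤ j))) (proj₂ (proj₂ (proj₂ rec)) j))))
      lem : ∀ m K e₀ e t v u → ((K * e₀ - t) * m * + 0 + (K * e₀ - t) * v) + (u * + 0 + (K * (m * e - e₀ * v) + t * v)) ≡ m * K * e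
      lem = solve-∀

  -- Roots and stabilizers of regular vectors

  _⁺ : ℤ → ℤ
  (+ n) ⁺ = + n
  -[1+ n ] ⁺ = + 0

  ⁺-nonneg : ∀ x → + 0 ≤ x ⁺
  ⁺-nonneg (+ n) = +≤+ ℕ.z≤n
  ⁺-nonneg -[1+ n ] = ≤-refl

  ⁺-split : ∀ x → x ≡ x ⁺ - (- x) ⁺
  ⁺-split (+ zero) = refl
  ⁺-split +[1+ n ] = sym (+-identityʳ _)
  ⁺-split -[1+ n ] = refl

  ⁺-disjoint : ∀ x → x ⁺ * (- x) ⁺ ≡ + 0
  ⁺-disjoint (+ zero) = refl
  ⁺-disjoint +[1+ n ] = *-zeroʳ +[1+ n ]
  ⁺-disjoint -[1+ n ] = refl

  ⁺-≡0 : ∀ x → x ⁺ ≡ + 0 → x ≤ + 0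
  ⁺-≡0 (+ n) p = ≤-reflexive p
  ⁺-≡0 -[1+ n ] p = -≤+

  ⁺-*-pos : ∀ c → + 0 < c → ∀ x → (c * x) ⁺ ≡ c * x ⁺
  ⁺-*-pos +[1+ m ] _ (+ zero) = trans (cong _⁺ (*-zeroʳ +[1+ m ])) (sym (*-zeroʳ +[1+ m ]))
  ⁺-*-pos +[1+ m ] _ +[1+ n ] = refl
  ⁺-*-pos +[1+ m ] _ -[1+ n ] = sym (*-zeroʳ +[1+ m ])
  ⁺-*-pos (+ zero) (+<+ ()) _

  unit-factor : ∀ {m x} → + 0 ≤ m → m * x ≡ + 1 → m ≡ + 1
  unit-factor {m} {x} m≥0 eq = trans (sym (0≤i⇒+∣i∣≡i m≥0))
    (cong +_ (ℕ.m*n≡1⇒m≡1 ∣ m ∣ ∣ x ∣ (trans (sym (abs-* m x)) (cong ∣_∣ eq))))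

  -- Off-diagonal entries occur in equal pairs. The evenness raises the lower bound for the norm of
  -- a nonzero positive part from `D` to `2 D`, which is what `root-sign` needs.
  sum-symmetric-even : ∀ {n} (M : Fin n → Fin n → ℤ) → (∀ i j → M i j ≡ M j i) →
    (D : Vecℤ n) → (∀ i → M i i ≡ + 2 * D i) → Σ ℤ λ q → sumℤ (λ i → sumℤ (M i)) ≡ + 2 * q
  sum-symmetric-even {zero} M M-sym D M-diag = + 0 , refl
  sum-symmetric-even {suc n} M M-sym D M-diag
    with sum-symmetric-even (λ i j → M (suc i) (suc j)) (λ i j → M-sym (suc i) (suc j)) (D ∘ suc) (M-diag ∘ suc)
  ... | q , eq = D zero + s + q , trans (cong₂ _+_ (cong (_+ s) (M-diag zero))
      (trans (sum-+ (λ i → M (suc i) zero) _) (cong₂ _+_ (sum-cong (λ i → M-sym (suc i) zero)) eq)))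
      (lem (D zero) s q)
    where
    s : ℤ
    s = sumℤ (λ j → M zero (suc j))
    lem : ∀ x s q → + 2 * x + s + (s + + 2 * q) ≡ + 2 * (x + s + q)
    lem = solve-∀

  NonNeg NonPos : ∀ {r} → Vecℤ r → Set
  NonNeg a = ∀ k → + 0 ≤ a k
  NonPos a = ∀ k → a k ≤ + 0

  nonpos-neg : ∀ {r} {a : Vecℤ r} → NonPos a → NonNeg (negV a)
  nonpos-neg p k = neg-mono-≤ (p k)

  linear-nonpos : ∀ {r} {f : Vecℤ r → ℤ} → Linear f → (∀ i → + 0 ≤ f (unitℤ i)) →
    ∀ {a} → NonPos a → f a ≤ + 0
  linear-nonpos {f = f} L p {a} q = subst (_≤ + 0) (neg-involutive (f a)) (neg-mono-≤
    (subst (+ 0 ≤_) (linear-neg L a) (linear-nonneg L p (nonpos-neg q))))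

  module RootSystem {r} (C : CartanMatrix r) (H : IsIrreducibleFiniteCartan C) where
    open IsIrreducibleFiniteCartan H
    open Action C
    open Involutive diag

    α : Fin r → Vecℤ r
    α = unitℤ

    ⟨α_∨,_⟩ : Fin r → Vecℤ r → ℤ
    ⟨α i ∨, a ⟩ = pairℤ C (unitℤ i) a

    _≈_ : List (Fin r) → List (Fin r) → Set
    u ≈ v = ∀ a → actR C u a ≐ actR C v a

    -- The identification of `V` with its dual under the invariant form: `α_i` corresponds to
    -- `d_i α_i^∨`.
    dual : Vecℤ r → Vecℤ r
    dual a i = a i * + d i

    B : Vecℤ r → Vecℤ r → ℤ
    B a b = pairℤ C (dual a) b

    d>0 : ∀ i → + 0 < + d i
    d>0 i = +<+ (d-pos i)

    M : CartanMatrix r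
    M i j = + d i * C i j

    B-M : ∀ a b → B a b ≡ pairℤ M a b
    B-M a b = sum-cong (λ i → sum-cong (λ j → cong (_* b j) (*-assoc (a i) (+ d i) (C i j))))

    B-linearʳ : ∀ a → Linear (B a)
    B-linearʳ a = pair-linearʳ C (dual a)

    B-sym : ∀ a b → B a b ≡ B b a
    B-sym a b = trans (B-M a b) (trans
      (sum-cong (λ i → sum-cong (λ j → cong (λ t → a i * t * b j) (symm i j))))
      (trans (pair-ᵀ M a b) (sym (B-M b a))))

    B-linearˡ : ∀ b → Linear (λ a → B a b)
    B-linearˡ b = linear-≗ (λ a → B-sym a b) (B-linearʳ b)

    dual-unit : ∀ i → dual (α i) ≐ (+ d i ⊙ α i)
    dual-unit i k with k ≟ i
    ... | yes refl = *-comm (+ 1) (+ d i)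
    ... | no _ = sym (*-zeroʳ (+ d i))

    B-simple : ∀ i a → B (α i) a ≡ + d i * ⟨α i ∨, a ⟩
    B-simple i a = trans (resp-≐ (pair-linearˡ C a) (dual-unit i)) (scl (pair-linearˡ C a) (+ d i) (α i))

    B-αα : ∀ i → B (α i) (α i) ≡ + d i * + 2
    B-αα i = trans (B-simple i (α i)) (cong (+ d i *_) (trans (pair-unit C i i) (diag i)))

    -- The reflection coefficients agree because `d_i ⟨α_i^∨, a⟩ = B a α_i`, by symmetry of `B`.
    -- Invariance of `B` follows, and facts can pass between the root lattice and the coroot
    -- lattice.
    dual-act : ∀ w a → dual (actR C w a) ≐ actR (C ᵀ) w (dual a)
    dual-act [] a k = refl
    dual-act (i ∷ w) a k = trans (cong (_* + d k) (simple-apply (coord-linear k) i wa))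
      (trans (lem (wa k) ⟨α i ∨, wa ⟩ (α i k) (+ d k))
      (trans (cong₂ (λ x y → x - ⟨α i ∨, wa ⟩ * y) (dual-act w a k) (dual-unit i k))
      (trans (lem′ (actR (C ᵀ) w (dual a) k) ⟨α i ∨, wa ⟩ (+ d i) (α i k))
      (trans (cong (λ c → actR (C ᵀ) w (dual a) k - c * α i k)
        (trans (sym (B-simple i wa)) (trans (B-sym (α i) wa)
          (trans (resp-≐ (pair-linearˡ C (α i)) (dual-act w a)) (sym (pair-ᵀ C (α i) (actR (C ᵀ) w (dual a))))))))
        (sym (Action.simple-apply (C ᵀ) (coord-linear k) i (actR (C ᵀ) w (dual a))))))))
      where
      wa : Vecℤ r
      wa = actR C w a
      lem : ∀ x c u d → (x - c * u) * d ≡ x * d - c * (u * d)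
      lem = solve-∀
      lem′ : ∀ x c d u → x - c * (d * u) ≡ x - (d * c) * u
      lem′ = solve-∀

    B-act : ∀ w a b → B (actR C w a) b ≡ B a (actR C (reverse w) b)
    B-act w a b = trans (resp-≐ (pair-linearˡ C b) (dual-act w a)) (pair-act C w (dual a) b)

    B-isometry : ∀ w a b → B (actR C w a) (actR C w b) ≡ B a b
    B-isometry w a b = trans (B-act w a (actR C w b)) (resp-≐ (B-linearʳ a) (act-reverse w b))

    B-root-norm : ∀ w i → B (actR C w (α i)) (actR C w (α i)) ≡ + d i * + 2
    B-root-norm w i = trans (B-isometry w (α i) (α i)) (B-αα i)

    B-root : ∀ w i a → B (actR C w (α i)) a ≡ + d i * ⟨α i ∨, actR C (reverse w) a ⟩
    B-root w i a = trans (B-act w (α i) a) (B-simple i (actR C (reverse w) a))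

    B-definite : ∀ x → B x x ≤ + 0 → ∀ k → x k ≡ + 0
    B-definite x p with all? (λ k → x k Data.Integer.≟ + 0)
    ... | yes q = q
    ... | no ¬q = ⊥-elim (<⇒≱ (posdef x ¬q) p)

    B-nonneg : ∀ x → + 0 ≤ B x x
    B-nonneg x with + 0 ≤? B x x
    ... | yes p = p
    -- A negative norm would make `x` vanish by `B-definite`, and then the norm is zero.
    ... | no ¬p = ⊥-elim (¬p (≤-reflexive (sym (trans (resp-≐ (B-linearʳ x) {x} {+ 0 ⊙ x} (B-definite x (<⇒≤ (≰⇒> ¬p))))
                                                      (scl (B-linearʳ x) (+ 0) x)))))

    root-act : ∀ w {a} → IsRoot C a → IsRoot C (actR C w a)
    root-act w (v , i , p) = w ++ v , i , λ k →
      trans (act-cong w p k) (cong (λ x → x k) (sym (act-++ w v (α i))))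

    root-neg : ∀ {a} → IsRoot C a → IsRoot C (negV a)
    root-neg (v , i , p) = v ++ i ∷ [] , i , λ k →
      trans (cong -_ (p k)) (sym (trans (cong (λ x → x k) (act-++ v (i ∷ []) (α i)))
        (trans (act-cong v (simple-unit i) k) (act-neg v (α i) k))))

    root-simple : ∀ i → IsRoot C (α i)
    root-simple i = [] , i , λ _ → refl

    root-nonzero : ∀ {β} → IsRoot C β → ¬ (∀ k → β k ≡ + 0)
    root-nonzero (w , i , p) z = <⇒≢ (0<-* (d>0 i) (+<+ (ℕ.s≤s ℕ.z≤n)))
      (trans (sym (trans (resp-≐ (B-linearʳ β) {β} {+ 0 ⊙ β} (λ k → trans (sym (p k)) (z k))) (scl (B-linearʳ β) (+ 0) β)))
             (B-root-norm w i))
      where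
      β : Vecℤ r
      β = actR C w (α i)

    -- D γ⁺ is β⁺ in coroot coordinates, so the norm of β⁺ is D times an even number.
    positive-part-norm : ∀ β D γ → + 0 < D → dual β ≐ (D ⊙ γ) → ¬ (∀ k → β k ⁺ ≡ + 0) →
      + 2 * D ≤ B (_⁺ ∘ β) (_⁺ ∘ β)
    positive-part-norm β D γ D>0 eq β⁺≢0 = ≤-by
      (0≤-* (0≤-* {+ 2} (+≤+ ℕ.z≤n) (<⇒≤ D>0)) (0≤-diff (0<⇒1≤ q>0)))
      (trans (lem D q) (cong (_- + 2 * D) (sym value)))
      where
      b g : Vecℤ r
      b = _⁺ ∘ β
      g = _⁺ ∘ γ
      dual-b : dual b ≐ (D ⊙ g)
      dual-b k = trans (*-comm (β k ⁺) (+ d k)) (trans (sym (⁺-*-pos (+ d k) (d>0 k) (β k)))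
        (trans (cong _⁺ (trans (*-comm (+ d k) (β k)) (eq k))) (⁺-*-pos D D>0 (γ k))))
      -- The entries of `S` add up to the norm of `b` divided by `D`. Its symmetry is that of `M`,
      -- visible after multiplication by `D` because `D g_i = b_i d_i`.
      S : Fin r → Fin r → ℤ
      S i j = g i * C i j * b j
      S-sym : ∀ i j → S i j ≡ S j i
      S-sym i j = *-cancelˡ-pos D>0
        (trans (lem₁ D (g i) (C i j) (b j)) (trans (cong (λ t → t * C i j * b j) (sym (dual-b i)))
        (trans (lem₂ (b i) (+ d i) (C i j) (b j)) (trans (cong (λ t → b i * t * b j) (symm i j))
        (trans (lem₃ (b i) (+ d j) (C j i) (b j)) (trans (cong (λ t → t * C j i * b i) (dual-b j))
         (sym (lem₁ D (g j) (C j i) (b i)))))))))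
        where
        lem₁ : ∀ D g c b → D * (g * c * b) ≡ D * g * c * b
        lem₁ = solve-∀
        lem₂ : ∀ x d c y → x * d * c * y ≡ x * (d * c) * y
        lem₂ = solve-∀
        lem₃ : ∀ x d c y → x * (d * c) * y ≡ y * d * c * x
        lem₃ = solve-∀
      even : Σ ℤ λ q → sumℤ (λ i → sumℤ (S i)) ≡ + 2 * q
      even = sum-symmetric-even S S-sym (λ i → g i * b i)
        (λ i → trans (cong (λ t → g i * t * b i) (diag i)) (lem₄ (g i) (b i)))
        where
        lem₄ : ∀ x y → x * + 2 * y ≡ + 2 * (x * y)
        lem₄ = solve-∀
      q : ℤ
      q = proj₁ even
      value : B b b ≡ + 2 * D * q
      value = trans (resp-≐ (pair-linearˡ C b) dual-b) (trans (scl (pair-linearˡ C b) D g)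
        (trans (cong (D *_) (proj₂ even)) (lem₅ D q)))
        where
        lem₅ : ∀ D q → D * (+ 2 * q) ≡ + 2 * D * q
        lem₅ = solve-∀
      q>0 : + 0 < q
      q>0 = 0<-cancel-* (0<-* {+ 2} (+<+ (ℕ.s≤s ℕ.z≤n)) D>0) (subst (+ 0 <_) value (posdef b β⁺≢0))
      lem : ∀ D q → + 2 * D * (q - + 1) ≡ + 2 * D * q - + 2 * D
      lem = solve-∀

    -- The cross term is nonpositive: the two parts have disjoint supports, so only off-diagonal
    -- Cartan entries contribute to it.
    split-norm : ∀ β → B (_⁺ ∘ β) (_⁺ ∘ β) + B (_⁺ ∘ negV β) (_⁺ ∘ negV β) ≤ B β β
    split-norm β = ≤-by (0≤-* {+ 2} (+≤+ ℕ.z≤n) (0≤-diff cross)) (trans (lem (B b b) (B c c) (B b c)) (cong (_- (B b b + B c c)) (sym value)))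
      where
      b c : Vecℤ r
      b = _⁺ ∘ β
      c = _⁺ ∘ negV β
      term : ∀ i j → b i * + d i * C i j * c j ≤ + 0
      term i j with i ≟ j
      ... | yes refl = ≤-reflexive (trans (lem₀ (b i) (+ d i) (C i i) (c i))
              (trans (cong (+ d i * C i i *_) (⁺-disjoint (β i))) (*-zeroʳ (+ d i * C i i))))
        where
        lem₀ : ∀ b d m c → b * d * m * c ≡ d * m * (b * c)
        lem₀ = solve-∀
      ... | no i≢j = ≤-by
              (0≤-* (0≤-* (0≤-* (⁺-nonneg (β i)) (<⇒≤ (d>0 i))) (0≤-diff (offdiag i j i≢j))) (⁺-nonneg (- β j)))
              (lem₀ (b i) (+ d i) (C i j) (c j))
        where
        lem₀ : ∀ b d m c → b * d * (+ 0 - m) * c ≡ + 0 - b * d * m * c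
        lem₀ = solve-∀
      cross : B b c ≤ + 0
      cross = sum-nonpos (λ i → sum-nonpos (term i))
      β-split : β ≐ (b ⊕ (- + 1) ⊙ c)
      β-split k = trans (⁺-split (β k)) (cong (_+_ (b k)) (sym (-1*i≡-i (c k))))
      value : B β β ≡ B b b - + 2 * B b c + B c c
      value = trans (resp-≐ (B-linearʳ β) β-split) (trans (linear-sub (B-linearʳ β) b (+ 1) c)
        (trans (cong₂ (λ x y → x - + 1 * y) (part b) (part c))
        (trans (cong (λ t → B b b - + 1 * t - + 1 * (B b c - + 1 * B c c)) (B-sym c b)) (lem₁ (B b b) (B b c) (B c c)))))
        where
        part : ∀ x → B β x ≡ B b x - + 1 * B c x
        part x = trans (resp-≐ (B-linearˡ x) β-split) (linear-sub (B-linearˡ x) b (+ 1) c)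
        lem₁ : ∀ x y z → x - + 1 * y - + 1 * (y - + 1 * z) ≡ x - + 2 * y + z
        lem₁ = solve-∀
      lem : ∀ x z y → + 2 * (+ 0 - y) ≡ x - + 2 * y + z - (x + z)
      lem = solve-∀

    -- The norm of β is 2D, and each of β⁺ and β⁻ would contribute at least 2D to it if nonzero.
    root-sign : ∀ {β} → IsRoot C β → NonNeg β ⊎ NonPos β
    root-sign {β} (w , i , p) with all? (λ k → + 0 ≤? β k)
    ... | yes q = inj₁ q
    ... | no ¬q = inj₂ nonpos
      where
      γ : Vecℤ r
      γ = actR (C ᵀ) w (α i)
      D : ℤ
      D = + d i
      dual-β : dual β ≐ (D ⊙ γ)
      dual-β k = trans (cong (_* + d k) (p k)) (trans (dual-act w (α i) k)
        (trans (Action.act-cong (C ᵀ) w (dual-unit i) k) (scl (Action.act-linear (C ᵀ) (coord-linear k) w) D (α i))))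
      dual-negβ : dual (negV β) ≐ (D ⊙ negV γ)
      dual-negβ k = trans (sym (neg-distribˡ-* (β k) (+ d k))) (trans (cong -_ (dual-β k)) (neg-distribʳ-* D (γ k)))
      norm : B β β ≡ D * + 2
      norm = trans (resp-≐ (B-linearʳ β) p) (trans (resp-≐ (B-linearˡ _) p) (B-root-norm w i))
      neg-part : + 2 * D ≤ B (_⁺ ∘ negV β) (_⁺ ∘ negV β)
      neg-part = positive-part-norm (negV β) D (negV γ) (d>0 i) dual-negβ
        (λ z → ¬q (λ k → subst (+ 0 ≤_) (neg-involutive (β k)) (neg-mono-≤ (⁺-≡0 (- β k) (z k)))))
      nonpos : NonPos β
      nonpos k with β k ≤? + 0
      ... | yes βk≤0 = βk≤0
      ... | no βk≰0 = ⊥-elim (<⇒≱ (0<-* (d>0 i) (+<+ (ℕ.s≤s ℕ.z≤n)))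
            (≤-by (0≤-diff (≤-trans (+-mono-≤ pos-part neg-part) (split-norm β))) (trans (cong (_- (+ 2 * D + + 2 * D)) norm) (lem D))))
        where
        pos-part : + 2 * D ≤ B (_⁺ ∘ β) (_⁺ ∘ β)
        pos-part = positive-part-norm β D γ (d>0 i) dual-β (λ z → βk≰0 (⁺-≡0 (β k) (z k)))
        lem : ∀ D → D * + 2 - (+ 2 * D + + 2 * D) ≡ + 0 - D * + 2
        lem = solve-∀

    root-height-pos : ∀ {β} → IsRoot C β → NonNeg β → + 0 < height β
    root-height-pos {β} R p with + 0 <? height β
    ... | yes q = q
    ... | no ¬q = ⊥-elim (root-nonzero {β} R (sum-nonneg-0 {f = β} p (≮⇒≥ ¬q)))

    -- `s_i` changes only the `i`-th coordinate. If the image is nonpositive, all other coordinates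
    -- of `β` vanish and `β` is a multiple of `α_i`; the multiple is 1 because `w⁻¹ β = α_j` has a
    -- coordinate equal to 1.
    simple-permutes : ∀ i {β} → IsRoot C β → NonNeg β → NonNeg (sRefR C i β) ⊎ β ≐ α i
    simple-permutes i {β} R@(w , j , p) pos with root-sign (root-act (i ∷ []) R)
    ... | inj₁ q = inj₁ q
    ... | inj₂ q = inj₂ (λ k → trans (multiple k) (trans (cong (_* α i k) βᵢ≡1) (*-identityˡ (α i k))))
      where
      multiple : β ≐ (β i ⊙ α i)
      multiple k with k ≟ i | q k
      ... | yes refl | _ = sym (*-identityʳ (β i))
      ... | no k≢i | qk = trans (≤-antisym (subst (_≤ + 0) (+-identityʳ (β k)) qk) (pos k)) (sym (*-zeroʳ (β i)))
      βᵢ≡1 : β i ≡ + 1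
      βᵢ≡1 = unit-factor {x = actR C (reverse w) (α i) j} (pos i)
        (trans (sym (scl (act-linear (coord-linear j) (reverse w)) (β i) (α i)))
        (trans (act-cong (reverse w) (λ k → trans (sym (multiple k)) (p k)) j)
        (trans (act-reverse w (α j) j) (unit-same j))))

    ≈-trans : ∀ {u v w} → u ≈ v → v ≈ w → u ≈ w
    ≈-trans p q a k = trans (p a k) (q a k)

    -- `w` conjugates `s_t` into `s_i`. As an isometry it forces `d i` and `d t` to agree, which
    -- turns invariance of `B` into invariance of the pairing with the simple coroots.
    conjugate-simple : ∀ w t i → actR C w (α t) ≐ α i → ∀ a → sRefR C i (actR C w (sRefR C t a)) ≐ actR C w a
    conjugate-simple w t i p a k = trans (simple-apply (coord-linear k) i b)
      (trans (cong₂ (λ x y → x - y * α i k) b-coord pairing) (lem (actR C w a k) ⟨α t ∨, a ⟩ (α i k)))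
      where
      b : Vecℤ r
      b = actR C w (sRefR C t a)
      b-coord : b k ≡ actR C w a k - ⟨α t ∨, a ⟩ * α i k
      b-coord = trans (simple-apply (act-linear (coord-linear k) w) t a)
        (cong (λ x → actR C w a k - ⟨α t ∨, a ⟩ * x) (p k))
      d-eq : + d i ≡ + d t
      d-eq = *-cancelʳ-≡ (+ d i) (+ d t) (+ 2) (trans (sym (B-αα i)) (trans (sym
        (trans (resp-≐ (B-linearʳ (actR C w (α t))) p) (resp-≐ (B-linearˡ (α i)) p))) (B-root-norm w t)))
      pairing : ⟨α i ∨, b ⟩ ≡ - ⟨α t ∨, a ⟩
      pairing = *-cancelˡ-pos (d>0 i) (trans (sym (B-simple i b)) (trans (sym (resp-≐ (B-linearˡ b) p))
        (trans (B-isometry w (α t) (sRefR C t a)) (trans (B-simple t (sRefR C t a))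
        (trans (cong₂ _*_ (sym d-eq) (trans (simple-apply (pair-linearʳ C (α t)) t a)
          (trans (cong (λ c → ⟨α t ∨, a ⟩ - ⟨α t ∨, a ⟩ * c) (trans (pair-unit C t t) (diag t))) (lem₂ ⟨α t ∨, a ⟩)))) refl)))))
        where
        lem₂ : ∀ x → x - x * + 2 ≡ - x
        lem₂ = solve-∀
      lem : ∀ x c u → x - c * u - - c * u ≡ x
      lem = solve-∀

    -- The deletion condition. Apply the letters of `w` to `α_t` one by one, from the right: the
    -- letter `i` at which the sign turns meets the root `α_i` itself, by `simple-permutes`. There
    -- the suffix conjugates `s_t` into `s_i`, and both letters cancel.
    deletion : ∀ w t → NonPos (actR C w (α t)) →
      Σ (List (Fin r)) λ v → (suc (length v) ≡ length w) × ((w ++ t ∷ []) ≈ v)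
    deletion [] t p = ⊥-elim (<⇒≱ (+<+ (ℕ.s≤s ℕ.z≤n)) (subst (_≤ + 0) (unit-same t) (p t)))
    deletion (i ∷ w) t p with root-sign (root-act w (root-simple t))
    ... | inj₂ np = let v , len , eq = deletion w t np in
          i ∷ v , cong suc len , λ a → act-cong (i ∷ []) (eq a)
    ... | inj₁ pos with simple-permutes i (root-act w (root-simple t)) pos
    ...   | inj₂ eq = w , refl , λ a k → trans
            (cong (λ x → sRefR C i x k) (act-++ w (t ∷ []) a)) (conjugate-simple w t i eq a k)
    ...   | inj₁ pos′ = ⊥-elim (root-nonzero (root-act (i ∷ w) (root-simple t)) (λ k → ≤-antisym (p k) (pos′ k)))

    -- If the word ends in `t`, the rest of it sends `α_t` to `- u α_t`, which is nonpositive, so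
    -- `deletion` gives a shorter word with the same action. The word need not be reduced.
    positive-trivial : ∀ n u → length u ℕ.< n → (∀ i → NonNeg (actR C u (α i))) → u ≈ []
    positive-trivial (suc n) u (ℕ.s≤s le) pos with initLast u
    ... | [] = λ _ _ → refl
    ... | w ∷ʳ′ t = λ a → ≈-trans {w ++ t ∷ []} {v} {[]} eq (positive-trivial n v shorter (λ i k → subst (+ 0 ≤_) (eq (α i) k) (pos i k))) a
      where
      np : NonPos (actR C w (α t))
      np k = subst (_≤ + 0) (neg-involutive _) (neg-mono-≤ (subst (+ 0 ≤_)
        (trans (cong (λ x → x k) (act-++ w (t ∷ []) (α t))) (trans (act-cong w (simple-unit t) k) (act-neg w (α t) k))) (pos t k)))
      del : Σ (List (Fin r)) λ v → (suc (length v) ≡ length w) × ((w ++ t ∷ []) ≈ v)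
      del = deletion w t np
      v : List (Fin r)
      v = proj₁ del
      eq : (w ++ t ∷ []) ≈ v
      eq = proj₂ (proj₂ del)
      shorter : length v ℕ.< n
      shorter = ℕ.≤-trans (ℕ.≤-reflexive (proj₁ (proj₂ del)))
        (ℕ.≤-trans (ℕ.≤-trans (ℕ.m≤m+n (length w) 1) (ℕ.≤-reflexive (sym (List.length-++ w)))) le)

    -- Squared distances, dominant conjugates and stabilizers

    distance : Vecℤ r → Vecℤ r → ℤ
    distance η ξ = B (η ⊕ (- + 1) ⊙ ξ) (η ⊕ (- + 1) ⊙ ξ)

    distance-nonneg : ∀ η ξ → + 0 ≤ distance η ξ
    distance-nonneg η ξ = B-nonneg (η ⊕ (- + 1) ⊙ ξ)

    distance-expand : ∀ η ξ → distance η ξ ≡ B η η - + 2 * B η ξ + B ξ ξ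
    distance-expand η ξ = trans (linear-sub (B-linearʳ (η ⊕ (- + 1) ⊙ ξ)) η (+ 1) ξ)
      (trans (cong₂ (λ x y → x - + 1 * y) (linear-sub (B-linearˡ η) η (+ 1) ξ) (linear-sub (B-linearˡ ξ) η (+ 1) ξ))
      (trans (cong (λ t → B η η - + 1 * t - + 1 * (B η ξ - + 1 * B ξ ξ)) (B-sym ξ η)) (lem (B η η) (B η ξ) (B ξ ξ))))
      where
      lem : ∀ x y z → x - + 1 * y - + 1 * (y - + 1 * z) ≡ x - + 2 * y + z
      lem = solve-∀

    -- If `η` and `ξ` lie on opposite sides of the hyperplane of `β`, reflecting `η` brings it
    -- closer to `ξ`: norms are kept, and the cross term improves by a quantity of the sign of
    -- `- B β η * B β ξ`.
    distance-reflect : ∀ v i η ξ → B (actR C v (α i)) η * B (actR C v (α i)) ξ < + 0 →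
      distance (actR C (reflWord v i) η) ξ < distance η ξ
    distance-reflect v i η ξ opposite = <-by
      (0<-cancel-* (d>0 i) (subst (+ 0 <_) (lem₁ (+ d i) c b) (0<-* {+ 2} (+<+ (ℕ.s≤s ℕ.z≤n)) (0<-diff neg′)))) value
      where
      β : Vecℤ r
      β = actR C v (α i)
      c b : ℤ
      c = ⟨α i ∨, actR C (reverse v) η ⟩
      b = B β ξ
      neg′ : + d i * c * b < + 0
      neg′ = subst (λ t → t * b < + 0) (B-root v i η) opposite
      lem₁ : ∀ d c b → + 2 * (+ 0 - d * c * b) ≡ d * (- (+ 2 * c * b))
      lem₁ = solve-∀
      lem₂ : ∀ x y z c b → - (+ 2 * c * b) ≡ (x - + 2 * y + z) - (x - + 2 * (y - c * b) + z)
      lem₂ = solve-∀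
      value : - (+ 2 * c * b) ≡ distance η ξ - distance (actR C (reflWord v i) η) ξ
      value = trans (lem₂ (B η η) (B η ξ) (B ξ ξ) c b) (sym (cong₂ _-_ (distance-expand η ξ)
        (trans (distance-expand (actR C (reflWord v i) η) ξ)
          (cong₂ (λ x y → x - + 2 * y + B ξ ξ) (B-isometry (reflWord v i) η η)
            (reflection-apply (B-linearˡ ξ) v i η)))))

    Regular : Vecℤ r → Set
    Regular ξ = ∀ {β} → IsRoot C β → B ξ β ≢ + 0

    -- Each simple reflection in a root negative on `ξ` brings `ξ` closer to the strictly dominant
    -- `R`; `n` bounds the integer that decreases. Regularity makes the final inequalities strict.
    dominant-conjugate : ∀ R → (∀ i → + 0 < B R (α i)) → ∀ n ξ → distance ξ R < + n → Regular ξ →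
      Σ (List (Fin r)) λ w → ∀ i → + 0 < B (actR C w ξ) (α i)
    dominant-conjugate R R-dom zero ξ lt reg = ⊥-elim (<⇒≱ lt (distance-nonneg ξ R))
    dominant-conjugate R R-dom (suc n) ξ lt reg with any? (λ i → B ξ (α i) <? + 0)
    ... | no none = [] , λ i → ≤∧≢⇒< (≮⇒≥ (λ p → none (i , p))) (λ e → reg (root-simple i) (sym e))
    ... | yes (i , ξᵢ<0) = w ++ i ∷ [] , λ j → subst (λ x → + 0 < B x (α j)) (sym (act-++ w (i ∷ []) ξ)) (proj₂ rec j)
      where
      closer : distance (sRefR C i ξ) R < distance ξ R
      closer = distance-reflect [] i ξ R (subst₂ (λ x y → x * y < + 0) (B-sym ξ (α i)) (B-sym R (α i))
        (<-by (0<-* (0<-diff ξᵢ<0) (R-dom i)) (lem (B ξ (α i)) (B R (α i)))))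
        where
        lem : ∀ x y → (+ 0 - x) * y ≡ + 0 - x * y
        lem = solve-∀
      rec : Σ (List (Fin r)) λ w → ∀ j → + 0 < B (actR C w (sRefR C i ξ)) (α j)
      rec = dominant-conjugate R R-dom n (sRefR C i ξ)
        (<-≤-trans closer (i<j⇒i≤pred[j] lt))
        (λ Rβ e → reg (root-act (i ∷ []) Rβ) (trans (sym (B-act (i ∷ []) ξ _)) e))
      w : List (Fin r)
      w = proj₁ rec

    -- The factor `K` is there because the Gram matrix need not be invertible over the integers.
    -- With `e = 1` this gives a multiple of `ρ^∨`, with `e = f ∘ α` a lattice vector representing
    -- `f`.
    dominant-vector : ∀ (e : Vecℤ r) → Σ (Vecℤ r) λ z → Σ ℤ λ K → (+ 0 < K) × (∀ j → B z (α j) ≡ K * e j)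
    dominant-vector e = let z , K , K>0 , eq = solve-posdef M symm M-pos e in
      z , K , K>0 , λ j → trans (B-M z (α j)) (eq j)
      where
      M-pos : ∀ x → ¬ (∀ i → x i ≡ + 0) → + 0 < pairℤ M x x
      M-pos x x≢0 = subst (+ 0 <_) (B-M x x) (posdef x x≢0)

    -- `B η` takes the same positive value at `u α_i` as at `α_i`, so `u α_i` cannot be a negative
    -- root, and `positive-trivial` applies.
    dominant-stabilizer : ∀ {η} → (∀ i → + 0 < B η (α i)) → ∀ u → actR C u η ≐ η → u ≈ []
    dominant-stabilizer {η} η-dom u fix = positive-trivial (suc (length u)) u ℕ.≤-refl
      (λ i → simple-positive i (root-sign (root-act u (root-simple i))))
      where
      invariant : ∀ i → B η (actR C u (α i)) ≡ B η (α i)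
      invariant i = trans (sym (resp-≐ (B-linearˡ (actR C u (α i))) {actR C u η} {η} fix)) (B-isometry u η (α i))
      simple-positive : ∀ i → NonNeg (actR C u (α i)) ⊎ NonPos (actR C u (α i)) → NonNeg (actR C u (α i))
      simple-positive i (inj₁ p) = p
      simple-positive i (inj₂ p) = ⊥-elim (<⇒≱ (η-dom i)
        (subst (_≤ + 0) (invariant i) (linear-nonpos (B-linearʳ η) (λ j → <⇒≤ (η-dom j)) p)))

    -- Conjugation by an element that makes `ξ` dominant reduces this to `dominant-stabilizer`.
    regular-stabilizer : ∀ {ξ} → Regular ξ → ∀ u → actR C u ξ ≐ ξ → u ≈ []
    regular-stabilizer {ξ} reg u fix = λ a k → trans (sym (act-reverse w (actR C u a) k))
      (trans (act-cong (reverse w) (λ l → trans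
          (act-cong w (act-cong u (λ m → sym (act-reverse w a m))) l)
          (trans (sym (conj (actR C w a) l)) (trivial (actR C w a) l))) k)
        (act-reverse w a k))
      where
      dom : Σ (Vecℤ r) λ z → Σ ℤ λ K → (+ 0 < K) × (∀ j → B z (α j) ≡ K * + 1)
      dom = dominant-vector (λ _ → + 1)
      R : Vecℤ r
      R = proj₁ dom
      R-dom : ∀ i → + 0 < B R (α i)
      R-dom i = subst (+ 0 <_) (sym (trans (proj₂ (proj₂ (proj₂ dom)) i) (*-identityʳ _))) (proj₁ (proj₂ (proj₂ dom)))
      far : distance ξ R < + suc ∣ distance ξ R ∣
      far = subst (_< + suc ∣ distance ξ R ∣) (0≤i⇒+∣i∣≡i (distance-nonneg ξ R)) (+<+ ℕ.≤-refl)
      dominated : Σ (List (Fin r)) λ w → ∀ i → + 0 < B (actR C w ξ) (α i)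
      dominated = dominant-conjugate R R-dom (suc ∣ distance ξ R ∣) ξ far reg
      w : List (Fin r)
      w = proj₁ dominated
      η : Vecℤ r
      η = actR C w ξ
      u₁ : List (Fin r)
      u₁ = w ++ (u ++ reverse w)
      conj : ∀ a → actR C u₁ a ≐ actR C w (actR C u (actR C (reverse w) a))
      conj a k = cong (λ x → x k) (trans (act-++ w (u ++ reverse w) a) (cong (actR C w) (act-++ u (reverse w) a)))
      fix₁ : actR C u₁ η ≐ η
      fix₁ k = trans (conj η k) (act-cong w (λ l → trans (act-cong u (act-reverse w ξ) l) (fix l)) k)
      trivial : u₁ ≈ []
      trivial = dominant-stabilizer (proj₂ dominated) u₁ fix₁

  -- Stabilizers modulo p of the points of the closed dilated alcove

  linear-scale : ∀ {r} {f : Vecℤ r → ℤ} → Linear f → ∀ c → Linear (λ a → c * f a)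
  linear-scale F c .resp-≐ p = cong (c *_) (resp-≐ F p)
  linear-scale {f = f} F c .add a b = trans (cong (c *_) (add F a b)) (*-distribˡ-+ c (f a) (f b))
  linear-scale {f = f} F c .scl e a = trans (cong (c *_) (scl F e a)) (lem c e (f a))
    where
    lem : ∀ c e x → c * (e * x) ≡ e * (c * x)
    lem = solve-∀

  coprime-divides : ∀ {m n} → Coprime m n → ∀ x y → + m * x ≡ + n * y → Σ ℤ λ z → y ≡ + m * z
  coprime-divides {m} {n} cop x y eq with ∣ᵤ⇒∣ {+ m} {y} (Coprimality.coprime-divisor cop
      (ℕ.divides ∣ x ∣ (trans (sym (abs-* (+ n) y)) (trans (cong ∣_∣ (sym eq)) (trans (abs-* (+ m) x) (ℕ.*-comm m ∣ x ∣))))))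
  ... | divides q e = q , trans e (*-comm q (+ m))

  module Stabilizer {r} (C : CartanMatrix r) (H : IsIrreducibleFiniteCartan C) where
    open RootSystem C H
    open IsIrreducibleFiniteCartan H using (diag)
    open Action C
    open Involutive diag
    private
      module A∨ = Action (C ᵀ)
      module I∨ = A∨.Involutive diag

    Stab : ℤ → Vecℤ r → List (Fin r) → Set
    Stab p y u = Σ (Vecℤ r) λ ν → actR (C ᵀ) u y ≐ (y ⊕ p ⊙ ν)

    stab-++ : ∀ p y u w → Stab p y u → Stab p y w → Stab p y (u ++ w)
    stab-++ p y u w (ν , eq) (ν′ , eq′) = ν ⊕ actR (C ᵀ) u ν′ , λ k →
      trans (cong (λ x → x k) (A∨.act-++ u w y)) (trans (A∨.act-cong u eq′ k)
      (trans (add (L k) y (p ⊙ ν′)) (trans (cong₂ _+_ (eq k) (scl (L k) p ν′)) (lem (y k) p (ν k) (actR (C ᵀ) u ν′ k)))))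
      where
      L : ∀ k → Linear (λ x → actR (C ᵀ) u x k)
      L k = A∨.act-linear (coord-linear k) u
      lem : ∀ y p n m → y + p * n + p * m ≡ y + p * (n + m)
      lem = solve-∀

    stab-reflection : ∀ p y v i m → pairℤ C y (actR C v (α i)) ≡ p * m → Stab p y (reflWord v i)
    stab-reflection p y v i m eq = (- m) ⊙ actR (C ᵀ) v (α i) , λ k →
      trans (I∨.reflection-apply (coord-linear k) v i y)
      (trans (cong (λ c → y k - c * actR (C ᵀ) v (α i) k) (trans (pair-ᵀ C (α i) (actR (C ᵀ) (reverse v) y))
        (trans (pair-act C (reverse v) y (α i))
        (trans (cong (λ w → pairℤ C y (actR C w (α i))) (List.reverse-involutive v)) eq))))
        (lem (y k) p m (actR (C ᵀ) v (α i) k)))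
      where
      lem : ∀ y p m b → y - p * m * b ≡ y + p * (- m * b)
      lem = solve-∀

    stab-pair : ∀ p y u (s : Stab p y u) a →
      pairℤ C y (actR C (reverse u) a) ≡ pairℤ C y a + p * pairℤ C (proj₁ s) a
    stab-pair p y u (ν , eq) a = trans (sym (pair-act C u y a)) (trans (resp-≐ (pair-linearˡ C a) eq)
      (trans (add (pair-linearˡ C a) y (p ⊙ ν)) (cong (_+_ (pairℤ C y a)) (scl (pair-linearˡ C a) p ν))))

    product : List (List (Fin r) × Fin r) → List (Fin r)
    product = concatMap (λ g → reflWord (proj₁ g) (proj₂ g))

    Gen : (Vecℤ r → Set) → List (Fin r) → Set
    Gen R u = Σ (List (List (Fin r) × Fin r)) λ gs →
      All (λ g → R (actR C (proj₁ g) (α (proj₂ g)))) gs × u ≈ product gs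

    reflection-involutive : ∀ v i a → actR C (reflWord v i) (actR C (reflWord v i) a) ≐ a
    reflection-involutive v i a k = trans (cong (λ x → x k) (act-++ v (i ∷ reverse v) (actR C (reflWord v i) a)))
      (trans (act-cong v (act-cong (i ∷ []) {b = actR C (i ∷ reverse v) a} (λ l →
          trans (cong (λ x → actR C (reverse v) x l) (act-++ v (i ∷ reverse v) a)) (act-reverse v _ l))) k)
      (trans (act-cong v (simple-involutive i _) k) (act-reverse′ v a k)))

    gen-nil : ∀ {R u} → u ≈ [] → Gen R u
    gen-nil p = [] , [] , p

    -- This is how the descent peels off a wall: the reflection is an involution, so a factorization
    -- of `s_β u` becomes one of `u`.
    gen-cons : ∀ {R u} v i → R (actR C v (α i)) → Gen R (reflWord v i ++ u) → Gen R u
    gen-cons {R} {u} v i Rβ (gs , all , eq) = (v , i) ∷ gs , Rβ ∷ all , λ a k →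
      trans (sym (reflection-involutive v i (actR C u a) k))
      (trans (act-cong (reflWord v i) (λ l → trans (cong (λ x → x l) (sym (act-++ (reflWord v i) u a))) (eq a l)) k)
        (cong (λ x → x k) (sym (act-++ (reflWord v i) (product gs) a))))

    module Alcove (θ : Vecℤ r) (hθ : IsHighestRoot C θ) (h : ℕ) (h-eq : + h ≡ + 1 + height θ)
                  (p : ℕ) (p>0 : + 0 < + p) (cop : Coprime p h) where

      θ-pos : ∀ k → + 1 ≤ θ k
      θ-pos k = subst (_≤ θ k) (unit-same k) (proj₂ hθ (α k) (root-simple k) k)

      height-θ>0 : + 0 < height θ
      height-θ>0 = root-height-pos (proj₁ hθ) (λ k → ≤-trans (+≤+ ℕ.z≤n) (θ-pos k))

      h>0 : + 0 < + h
      h>0 = subst (+ 0 <_) (sym h-eq) (+-mono-<-≤ {+ 0} (+<+ (ℕ.s≤s ℕ.z≤n)) (<⇒≤ height-θ>0))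

      root-height-< : ∀ {β} → IsRoot C β → + 0 < + h - height β
      root-height-< {β} R = 1≤⇒0< (≤-by (0≤-diff (sum-mono (proj₂ hθ β R)))
        (trans (lem (height θ) (height β)) (cong (λ t → t - height β - + 1) (sym h-eq))))
        where
        lem : ∀ t b → t - b ≡ + 1 + t - b - + 1
        lem = solve-∀

      root-height-> : ∀ {β} → IsRoot C β → + 0 < + h + height β
      root-height-> {β} R = subst (+ 0 <_) (cong (_+_ (+ h)) (trans (cong -_ (linear-neg height-linear β)) (neg-involutive (height β))))
        (root-height-< (root-neg R))

      affine-height-positive : ∀ {β} → IsRoot C β → ∀ m → + 0 < m → + 0 < height β + m * + h
      affine-height-positive {β} R m m>0 = subst (+ 0 <_) (lem (height β) m (+ h))
        (+-mono-<-≤ (root-height-> R) (0≤-* (0≤-diff (0<⇒1≤ m>0)) (<⇒≤ h>0)))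
        where
        lem : ∀ b m h → h + b + (m - + 1) * h ≡ b + m * h
        lem = solve-∀

      -- Roots have height strictly between `- h` and `h`, so the sign of `m` decides when `m ≠ 0`,
      -- and the sign of the root when `m = 0`.
      affine-height-nonzero : ∀ {β} → IsRoot C β → ∀ m → height β + m * + h ≢ + 0
      affine-height-nonzero {β} R m eq with <-cmp m (+ 0)
      ... | tri> _ _ m>0 = <⇒≢ (affine-height-positive R m m>0) (sym eq)
      ... | tri< m<0 _ _ = <⇒≢ (affine-height-positive (root-neg R) (- m) (neg-mono-< m<0))
        (sym (trans (cong (_+ - m * + h) (linear-neg height-linear β)) (trans (lem (height β) m (+ h)) (cong -_ eq))))
        where
        lem : ∀ b m h → - b + - m * h ≡ - (b + m * h)
        lem = solve-∀
      ... | tri≈ _ refl _ with root-sign R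
      ...   | inj₁ s = <⇒≢ (root-height-pos R s) (sym (trans (sym (+-identityʳ (height β))) eq))
      ...   | inj₂ s = <⇒≢ (root-height-pos (root-neg R) (nonpos-neg s))
                (sym (trans (linear-neg height-linear β) (cong -_ (trans (sym (+-identityʳ (height β))) eq))))

      -- The affine roots of height 1 are α₁, …, αᵣ (k = 0) and - θ + δ (k = 1); here δ is scaled to pδ,
      -- so Wall y holds of the gradients of the walls of p A∘ that contain y.
      Wall : Vecℤ r → Vecℤ r → Set
      Wall y β = IsRoot C β × Σ ℤ λ k → (pairℤ C y β + k * + p ≡ + 0) × (height β + k * + h ≡ + 1)

      module Point (y : Vecℤ r) (y-dom : ∀ i → + 0 ≤ pairℤ C y (α i)) (y-θ : pairℤ C y θ ≤ + p) where

        -- f is h times the functional of y - p ρ^∨ / h; it vanishes on no root since p is prime to h.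
        f : Vecℤ r → ℤ
        f a = + h * pairℤ C y a + - + p * height a

        f-linear : Linear f
        f-linear = linear-comb (pair-linearʳ C y) height-linear (+ h) (- + p)

        f-nonzero : ∀ {β} → IsRoot C β → f β ≢ + 0
        f-nonzero {β} R eq with coprime-divides (Coprimality.sym cop) (pairℤ C y β) (height β)
            (i-j≡0⇒i≡j _ _ (trans (lem (+ h) (pairℤ C y β) (+ p) (height β)) eq))
          where
          lem : ∀ h y p b → h * y - p * b ≡ h * y + - p * b
          lem = solve-∀
        -- The height of `β` is `h z`, so `β - z δ` would be an affine root of height zero.
        ... | z , e = affine-height-nonzero R (- z) (trans (cong (_+ - z * + h) e) (lem (+ h) z))
          where
          lem : ∀ h z → h * z + - z * h ≡ + 0
          lem = solve-∀

        -- Distances need a vector where `f` is a functional; `B` supplies one in the root lattice,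
        -- up to a positive factor.
        represented : Σ (Vecℤ r) λ z → Σ ℤ λ K → (+ 0 < K) × (∀ j → B z (α j) ≡ K * f (α j))
        represented = dominant-vector (f ∘ α)

        ξ : Vecℤ r
        ξ = proj₁ represented

        K : ℤ
        K = proj₁ (proj₂ represented)

        K>0 : + 0 < K
        K>0 = proj₁ (proj₂ (proj₂ represented))

        B-ξ : ∀ a → B ξ a ≡ K * f a
        B-ξ = linear-ext (B-linearʳ ξ) (linear-scale f-linear K) (proj₂ (proj₂ (proj₂ represented)))

        ξ-regular : Regular ξ
        ξ-regular {β} R eq = f-nonzero R (*-cancelˡ-pos K>0 (trans (sym (B-ξ β)) (trans eq (sym (*-zeroʳ K)))))

        -- For u y = y + pν, the image of pρ^∨/h under y + u (· - y) has value (p/h) (g u ν β + kh) on the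
        -- affine root β + kpδ.
        g : List (Fin r) → Vecℤ r → Vecℤ r → ℤ
        g u ν a = + 1 * height (actR C (reverse u) a) + - + h * pairℤ C ν a

        g-linear : ∀ u ν → Linear (g u ν)
        g-linear u ν = linear-comb (act-linear height-linear (reverse u)) (pair-linearʳ C ν) (+ 1) (- + h)

        -- As the affine map fixes `y`, its linear part sends `y - p ρ^∨ / h` to the difference of
        -- `y` and the image of `p ρ^∨ / h`, whose values are those of `g` times `p / h`.
        f-act : ∀ u (s : Stab (+ p) y u) a →
          f (actR C (reverse u) a) ≡ + h * pairℤ C y a - + p * g u (proj₁ s) a
        f-act u s a = trans (cong (λ t → + h * t + - + p * height (actR C (reverse u) a)) (stab-pair (+ p) y u s a))
          (lem (+ h) (+ p) (pairℤ C y a) (pairℤ C (proj₁ s) a) (height (actR C (reverse u) a)))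
          where
          lem : ∀ h p y n b → h * (y + p * n) + - p * b ≡ h * y - p * (+ 1 * b + - h * n)
          lem = solve-∀

        pair-y-θ-bound : ∀ {γ} → IsRoot C γ → pairℤ C y γ ≤ + p
        pair-y-θ-bound {γ} R = ≤-trans (linear-mono (pair-linearʳ C y) y-dom (proj₂ hθ γ R)) y-θ

        pair-y-nonpos : ∀ {γ} → NonPos γ → pairℤ C y γ ≤ + 0
        pair-y-nonpos = linear-nonpos (pair-linearʳ C y) y-dom

        -- u maps pρ^∨/h to the far side of the wall β + kpδ = 0 and fixes y, which is on the near side.
        crossed-wall : ∀ u (s : Stab (+ p) y u) {β} → IsRoot C β → ∀ k →
          + 0 ≤ pairℤ C y β + k * + p → g u (proj₁ s) β + k * + h ≤ + 0 → pairℤ C y β + k * + p ≡ + 0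
        crossed-wall u s {β} R k A≥0 N≤0 = ≤-antisym A≤0 A≥0
          where
          γ : Vecℤ r
          γ = actR C (reverse u) β
          Rγ : IsRoot C γ
          Rγ = root-act (reverse u) R
          -- Pulled back along the affine map, the wall becomes `γ + m p δ`, and the two given
          -- quantities record its values at `y` and, up to `p / h`, at `p ρ^∨ / h`. By `N≤0` the
          -- affine root `γ + m δ` is negative, and then `γ + m p δ` is nonpositive on the closed
          -- alcove.
          n m : ℤ
          n = pairℤ C (proj₁ s) β
          m = k - n
          A≡ : pairℤ C y β + k * + p ≡ pairℤ C y γ + m * + p
          A≡ = trans (lem (pairℤ C y β) (+ p) k n) (cong (_+ m * + p) (sym (stab-pair (+ p) y u s β)))
            where
            lem : ∀ y p k n → y + k * p ≡ y + p * n + (k - n) * p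
            lem = solve-∀
          N≡ : g u (proj₁ s) β + k * + h ≡ height γ + m * + h
          N≡ = lem (height γ) (+ h) k n
            where
            lem : ∀ b h k n → + 1 * b + - h * n + k * h ≡ b + (k - n) * h
            lem = solve-∀
          A≤0 : pairℤ C y β + k * + p ≤ + 0
          A≤0 with <-cmp m (+ 0)
          ... | tri> _ _ m>0 = ⊥-elim (<⇒≱ (affine-height-positive Rγ m m>0) (subst (_≤ + 0) N≡ N≤0))
          ... | tri< m<0 _ _ = subst (_≤ + 0) (sym A≡) (≤-by
                  (0≤-+ (0≤-diff (pair-y-θ-bound Rγ)) (0≤-* (0≤-diff (0<⇒1≤ (neg-mono-< m<0))) (<⇒≤ p>0)))
                  (lem (pairℤ C y γ) (+ p) m))
            where
            lem : ∀ y p m → p - y + (- m - + 1) * p ≡ + 0 - (y + m * p)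
            lem = solve-∀
          ... | tri≈ _ m≡0 _ with root-sign Rγ
          ...   | inj₁ pos = ⊥-elim (<⇒≱ (root-height-pos Rγ pos) (subst (_≤ + 0)
                    (trans N≡ (trans (cong (λ t → height γ + t * + h) m≡0) (+-identityʳ (height γ)))) N≤0))
          ...   | inj₂ nonpos = subst (_≤ + 0)
                    (sym (trans A≡ (trans (cong (λ t → pairℤ C y γ + t * + p) m≡0) (+-identityʳ _)))) (pair-y-nonpos nonpos)

        -- On a wall through `y`, `f β = - p` because the affine height is 1, while `f` at `u⁻¹ β`
        -- is `- p` times a nonpositive number. The latter is strictly positive since `f` vanishes
        -- on no root, so `ξ` and `u ξ` are separated by `β`.
        crossed-wall-closer : ∀ u (s : Stab (+ p) y u) v i k → let β = actR C v (α i) in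
          height β + k * + h ≡ + 1 → g u (proj₁ s) β + k * + h ≤ + 0 → pairℤ C y β + k * + p ≡ + 0 →
          distance (actR C (reflWord v i ++ u) ξ) ξ < distance (actR C u ξ) ξ
        crossed-wall-closer u s v i k ht N≤0 A≡0 =
          subst (λ η → distance η ξ < distance (actR C u ξ) ξ) (sym (act-++ (reflWord v i) u ξ))
            (distance-reflect v i (actR C u ξ) ξ (subst₂ (λ x y → x * y < + 0)
              (sym (trans (B-sym β (actR C u ξ)) (trans (B-act u ξ β) (B-ξ γ))))
              (sym (trans (B-sym β ξ) (B-ξ β)))
              (<-by (0<-* (0<-* K>0 fγ>0) (0<-* K>0 -fβ>0)) (lem₀ K (f γ) (f β)))))
          where
          β γ : Vecℤ r
          β = actR C v (α i)
          γ = actR C (reverse u) β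
          Rβ : IsRoot C β
          Rβ = v , i , λ _ → refl
          N A : ℤ
          N = g u (proj₁ s) β + k * + h
          A = pairℤ C y β + k * + p
          lem₀ : ∀ K x y → K * x * (K * - y) ≡ + 0 - K * x * (K * y)
          lem₀ = solve-∀
          fγ≡ : f γ ≡ + p * (+ 0 - N)
          fγ≡ = trans (f-act u s β) (trans (lem (+ h) (+ p) (pairℤ C y β) k (g u (proj₁ s) β))
            (trans (cong (λ t → + h * t - + p * N) A≡0) (lem′ (+ h) (+ p) N)))
            where
            lem : ∀ h p y k g → h * y - p * g ≡ h * (y + k * p) - p * (g + k * h)
            lem = solve-∀
            lem′ : ∀ h p N → h * + 0 - p * N ≡ p * (+ 0 - N)
            lem′ = solve-∀
          fγ>0 : + 0 < f γ
          fγ>0 = ≤∧≢⇒< (subst (+ 0 ≤_) (sym fγ≡) (0≤-* (<⇒≤ p>0) (0≤-diff N≤0)))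
            (λ e → f-nonzero (root-act (reverse u) Rβ) (sym e))
          -fβ>0 : + 0 < - f β
          -fβ>0 = subst (+ 0 <_) (sym (trans (lem (+ h) (+ p) (pairℤ C y β) k (height β))
            (trans (cong₂ (λ s t → + p * s - + h * t) ht A≡0) (lem′ (+ p) (+ h))))) p>0
            where
            lem : ∀ h p y k b → - (h * y + - p * b) ≡ p * (b + k * h) - h * (y + k * p)
            lem = solve-∀
            lem′ : ∀ p h → p * + 1 - h * + 0 ≡ p
            lem′ = solve-∀

        -- The values at the walls add up to h with the coefficients of θ, so if none is smaller than 1
        -- then all are equal to 1.
        uncrossed-trivial : ∀ u (s : Stab (+ p) y u) → (∀ i → + 0 < g u (proj₁ s) (α i)) →
          + 0 < + h - g u (proj₁ s) θ → u ≈ []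
        uncrossed-trivial u s gα gθ = regular-stabilizer ξ-regular u fixed
          where
          G : Vecℤ r → ℤ
          G a = + 1 * g u (proj₁ s) a + - + 1 * height a
          G-linear : Linear G
          G-linear = linear-comb (g-linear u (proj₁ s)) height-linear (+ 1) (- + 1)
          G-α : ∀ i → G (α i) ≡ g u (proj₁ s) (α i) - + 1
          G-α i = trans (cong (λ t → + 1 * g u (proj₁ s) (α i) + - + 1 * t) (height-unit i)) (lem (g u (proj₁ s) (α i)))
            where
            lem : ∀ x → + 1 * x + - + 1 * + 1 ≡ x - + 1
            lem = solve-∀
          G-α≥0 : ∀ i → + 0 ≤ G (α i)
          G-α≥0 i = subst (+ 0 ≤_) (sym (G-α i)) (0≤-diff (0<⇒1≤ (gα i)))
          G-θ≤0 : G θ ≤ + 0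
          G-θ≤0 = ≤-by (0≤-diff (0<⇒1≤ gθ)) (trans (cong (λ t → t - g u (proj₁ s) θ - + 1) h-eq) (lem (height θ) (g u (proj₁ s) θ)))
            where
            lem : ∀ t x → + 1 + t - x - + 1 ≡ + 0 - (+ 1 * x + - + 1 * t)
            lem = solve-∀
          θ≥0 : ∀ k → + 0 ≤ θ k
          θ≥0 k = ≤-trans (+≤+ ℕ.z≤n) (θ-pos k)
          terms : ∀ i → θ i * G (α i) ≡ + 0
          terms = sum-nonneg-0 (λ i → 0≤-* (θ≥0 i) (G-α≥0 i)) (subst (_≤ + 0) (linear-expand G-linear θ) G-θ≤0)
          g-α : ∀ i → g u (proj₁ s) (α i) ≡ height (α i)
          g-α i = trans (i-j≡0⇒i≡j _ _ (trans (sym (G-α i))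
            (*-cancelˡ-pos (1≤⇒0< (θ-pos i)) (trans (terms i) (sym (*-zeroʳ (θ i))))))) (sym (height-unit i))
          f-invariant : ∀ a → f (actR C (reverse u) a) ≡ f a
          f-invariant = linear-ext (act-linear f-linear (reverse u)) f-linear (λ i →
            trans (f-act u s (α i)) (trans (cong (λ t → + h * pairℤ C y (α i) - + p * t) (g-α i))
              (lem (+ h) (+ p) (pairℤ C y (α i)) (height (α i)))))
            where
            lem : ∀ h p y b → h * y - p * b ≡ h * y + - p * b
            lem = solve-∀
          B-fixed : ∀ a → B (actR C u ξ) a ≡ B ξ a
          B-fixed a = trans (B-act u ξ a) (trans (B-ξ _) (trans (cong (K *_) (f-invariant a)) (sym (B-ξ a))))
          fixed : actR C u ξ ≐ ξ
          -- By `B-fixed` the norm of `δ` is `B ξ δ - B ξ δ`, and definiteness makes `δ` vanish.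
          fixed k = i-j≡0⇒i≡j _ _ (trans (cong (_+_ (actR C u ξ k)) (sym (-1*i≡-i (ξ k)))) (B-definite δ (≤-reflexive
            (trans (linear-sub (B-linearˡ δ) (actR C u ξ) (+ 1) ξ) (trans (cong (_- + 1 * B ξ δ) (B-fixed δ)) (lem (B ξ δ))))) k))
            where
            δ : Vecℤ r
            δ = actR C u ξ ⊕ (- + 1) ⊙ ξ
            lem : ∀ x → x - + 1 * x ≡ + 0
            lem = solve-∀

        wall-stab : ∀ v i k → pairℤ C y (actR C v (α i)) + k * + p ≡ + 0 → Stab (+ p) y (reflWord v i)
        wall-stab v i k eq = stab-reflection (+ p) y v i (- k) (trans (lem (pairℤ C y (actR C v (α i))) k (+ p))
          (trans (cong (_- k * + p) eq) (lem′ k (+ p))))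
          where
          lem : ∀ y k p → y ≡ y + k * p - k * p
          lem = solve-∀
          lem′ : ∀ k p → + 0 - k * p ≡ p * - k
          lem′ = solve-∀

        stabilizer-generated : ∀ n u → distance (actR C u ξ) ξ < + n → Stab (+ p) y u → Gen (Wall y) u
        stabilizer-generated zero u lt s = ⊥-elim (<⇒≱ lt (distance-nonneg (actR C u ξ) ξ))
        stabilizer-generated (suc n) u lt s = search
          where
          reflect : ∀ v i k → let β = actR C v (α i) in height β + k * + h ≡ + 1 →
            + 0 ≤ pairℤ C y β + k * + p → g u (proj₁ s) β + k * + h ≤ + 0 → Gen (Wall y) u
          reflect v i k ht A≥0 N≤0 = gen-cons {Wall y} {u} v i (Rβ , k , A≡0 , ht)
            (stabilizer-generated n (reflWord v i ++ u)
              (<-≤-trans (crossed-wall-closer u s v i k ht N≤0 A≡0) (i<j⇒i≤pred[j] lt))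
              (stab-++ (+ p) y (reflWord v i) u (wall-stab v i k A≡0) s))
            where
            Rβ : IsRoot C (actR C v (α i))
            Rβ = v , i , λ _ → refl
            A≡0 : pairℤ C y (actR C v (α i)) + k * + p ≡ + 0
            A≡0 = crossed-wall u s Rβ k A≥0 N≤0
          reflect-θ : + h - g u (proj₁ s) θ ≤ + 0 → Gen (Wall y) u
          reflect-θ N≤0 = let v , i , eq = root-neg (proj₁ hθ)
                              -- The root `- θ` equals `v α_i` only pointwise; `value` carries the
                              -- functionals across.
                              value : ∀ {φ} → Linear φ → φ (actR C v (α i)) ≡ - φ θ
                              value = λ {φ} L → trans (sym (resp-≐ L eq)) (linear-neg L θ) in
            reflect v i (+ 1)
              (trans (cong₂ (λ x y → x + + 1 * y) (value height-linear) h-eq) (lem₁ (height θ)))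
              (subst (+ 0 ≤_) (trans (lem₂ (+ p) (pairℤ C y θ)) (cong (_+ + 1 * + p) (sym (value (pair-linearʳ C y))))) (0≤-diff y-θ))
              (subst (_≤ + 0) (trans (lem₂ (+ h) (g u (proj₁ s) θ)) (cong (_+ + 1 * + h) (sym (value (g-linear u (proj₁ s)))))) N≤0)
            where
            lem₁ : ∀ t → - t + + 1 * (+ 1 + t) ≡ + 1
            lem₁ = solve-∀
            lem₂ : ∀ p y → p - y ≡ - y + + 1 * p
            lem₂ = solve-∀
          search : Gen (Wall y) u
          search with any? (λ i → g u (proj₁ s) (α i) ≤? + 0) | + h - g u (proj₁ s) θ ≤? + 0
          ... | yes (i , N≤0) | _ = reflect [] i (+ 0) (trans (+-identityʳ _) (height-unit i))
                (subst (+ 0 ≤_) (sym (+-identityʳ _)) (y-dom i)) (subst (_≤ + 0) (sym (+-identityʳ _)) N≤0)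
          ... | no _ | yes N≤0 = reflect-θ N≤0
          ... | no α-ok | no θ-bad = gen-nil {Wall y} {u} (uncrossed-trivial u s (λ i → ≰⇒> (λ q → α-ok (i , q))) (≰⇒> θ-bad))

        stab⇒gen : ∀ u → Stab (+ p) y u → Gen (Wall y) u
        stab⇒gen u = stabilizer-generated (suc ∣ D ∣) u (subst (_< + suc ∣ D ∣) (0≤i⇒+∣i∣≡i (distance-nonneg (actR C u ξ) ξ)) (+<+ ℕ.≤-refl))
          where
          D : ℤ
          D = distance (actR C u ξ) ξ

  -- Rational points

  toℚᵘ-toℚ : ∀ x → ℚ.toℚᵘ (toℚ x) ℚᵘ.≃ mkℚᵘ x 0
  toℚᵘ-toℚ x = ℚ.toℚᵘ-fromℚᵘ (mkℚᵘ x 0)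

  toℚ-+ : ∀ x y → toℚ (x + y) ≡ toℚ x ℚ.+ toℚ y
  toℚ-+ x y = ℚ.toℚᵘ-injective (ℚᵘ.≃-trans (toℚᵘ-toℚ (x + y)) (ℚᵘ.≃-trans (*≡* (lem x y))
    (ℚᵘ.≃-sym (ℚᵘ.≃-trans (ℚ.toℚᵘ-homo-+ (toℚ x) (toℚ y)) (ℚᵘ.+-cong (toℚᵘ-toℚ x) (toℚᵘ-toℚ y))))))
    where
    lem : ∀ x y → (x + y) * + 1 ≡ (x * + 1 + y * + 1) * + 1
    lem = solve-∀

  toℚ-* : ∀ x y → toℚ (x * y) ≡ toℚ x ℚ.* toℚ y
  toℚ-* x y = ℚ.toℚᵘ-injective (ℚᵘ.≃-trans (toℚᵘ-toℚ (x * y)) (ℚᵘ.≃-trans (*≡* refl)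
    (ℚᵘ.≃-sym (ℚᵘ.≃-trans (ℚ.toℚᵘ-homo-* (toℚ x) (toℚ y)) (ℚᵘ.*-cong (toℚᵘ-toℚ x) (toℚᵘ-toℚ y))))))

  toℚ-neg : ∀ x → toℚ (- x) ≡ ℚ.- toℚ x
  toℚ-neg x = ℚ.toℚᵘ-injective (ℚᵘ.≃-trans (toℚᵘ-toℚ (- x))
    (ℚᵘ.≃-sym (ℚᵘ.≃-trans (ℚ.toℚᵘ-homo‿- (toℚ x)) (ℚᵘ.-‿cong (toℚᵘ-toℚ x)))))

  toℚ-injective : ∀ {x y} → toℚ x ≡ toℚ y → x ≡ y
  toℚ-injective {x} {y} eq with ℚᵘ.≃-trans (ℚᵘ.≃-sym (toℚᵘ-toℚ x)) (ℚᵘ.≃-trans (ℚᵘ.≃-reflexive (cong ℚ.toℚᵘ eq)) (toℚᵘ-toℚ y))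
  ... | *≡* e = trans (sym (*-identityʳ x)) (trans e (*-identityʳ y))

  toℚ-mono-< : ∀ {x y} → x < y → toℚ x ℚ.< toℚ y
  toℚ-mono-< {x} {y} x<y = ℚ.toℚᵘ-cancel-< (ℚᵘ.<-respˡ-≃ (ℚᵘ.≃-sym (toℚᵘ-toℚ x)) (ℚᵘ.<-respʳ-≃ (ℚᵘ.≃-sym (toℚᵘ-toℚ y))
    (*<* (subst₂ _<_ (sym (*-identityʳ x)) (sym (*-identityʳ y)) x<y))))

  toℚ-cancel-< : ∀ {x y} → toℚ x ℚ.< toℚ y → x < y
  toℚ-cancel-< {x} {y} lt with ℚᵘ.<-respˡ-≃ (toℚᵘ-toℚ x) (ℚᵘ.<-respʳ-≃ (toℚᵘ-toℚ y) (ℚ.toℚᵘ-mono-< lt))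
  ... | *<* e = subst₂ _<_ (*-identityʳ x) (*-identityʳ y) e

  denominator : ∀ q → Σ ℤ λ N → (+ 0 < N) × Σ ℤ λ n → toℚ N ℚ.* q ≡ toℚ n
  denominator q@(mkℚ n d-1 _) = +[1+ d-1 ] , +<+ (ℕ.s≤s ℕ.z≤n) , n , ℚ.toℚᵘ-injective
    (ℚᵘ.≃-trans (ℚ.toℚᵘ-homo-* (toℚ +[1+ d-1 ]) q) (ℚᵘ.≃-trans (ℚᵘ.*-congʳ {ℚ.toℚᵘ q} (toℚᵘ-toℚ +[1+ d-1 ]))
      (ℚᵘ.≃-trans (*≡* lem) (ℚᵘ.≃-sym (toℚᵘ-toℚ n)))))
    where
    lem : +[1+ d-1 ] * n * + 1 ≡ n * + (1 ℕ.* suc d-1)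
    lem = trans (*-identityʳ _) (trans (*-comm +[1+ d-1 ] n) (cong (λ t → n * + t) (sym (ℕ.*-identityˡ (suc d-1)))))

  reciprocal : ∀ {N} → + 0 < N → Σ ℚ λ c → (0ℚ ℚ.< c) × (c ℚ.* toℚ N ≡ 1ℚ)
  reciprocal {N} N>0 = (1/ toℚ N) {{nz}} , ℚ.positive⁻¹ _ {{ℚ.1/pos⇒pos (toℚ N)}} , ℚ.*-inverseˡ (toℚ N) {{nz}}
    where
    instance
      ps : ℚ.Positive (toℚ N)
      ps = ℚ.positive (toℚ-mono-< N>0)
    nz : ℚ.NonZero (toℚ N)
    nz = ℚ.pos⇒nonZero (toℚ N)

  -- Rational vectors are handled as x = c X with c rational and X integral.
  Scaled : ∀ {r} → ℚ → Vecℤ r → Vecℚ r → Set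
  Scaled c X x = ∀ k → x k ≡ c ℚ.* toℚ (X k)

  module _ (c : ℚ) where

    scaled-+ : ∀ x y → c ℚ.* toℚ x ℚ.+ c ℚ.* toℚ y ≡ c ℚ.* toℚ (x + y)
    scaled-+ x y = trans (sym (ℚ.*-distribˡ-+ c (toℚ x) (toℚ y))) (cong (c ℚ.*_) (sym (toℚ-+ x y)))

    scaled-- : ∀ x y → c ℚ.* toℚ x ℚ.- c ℚ.* toℚ y ≡ c ℚ.* toℚ (x - y)
    scaled-- x y = trans (cong (c ℚ.* toℚ x ℚ.+_) (trans (ℚ.neg-distribʳ-* c (toℚ y)) (cong (c ℚ.*_) (sym (toℚ-neg y)))))
      (scaled-+ x (- y))

    scaled-* : ∀ x y → c ℚ.* toℚ x ℚ.* toℚ y ≡ c ℚ.* toℚ (x * y)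
    scaled-* x y = trans (ℚ.*-assoc c (toℚ x) (toℚ y)) (cong (c ℚ.*_) (sym (toℚ-* x y)))

    sumℚ-scaled : ∀ {r} {f : Vecℚ r} {g : Vecℤ r} → (∀ i → f i ≡ c ℚ.* toℚ (g i)) → sumℚ f ≡ c ℚ.* toℚ (sumℤ g)
    sumℚ-scaled {zero} p = sym (ℚ.*-zeroʳ c)
    sumℚ-scaled {suc r} {g = g} p = trans (cong₂ ℚ._+_ (p zero) (sumℚ-scaled (p ∘ suc))) (scaled-+ (g zero) (sumℤ (g ∘ suc)))

    pair-scaled : ∀ {r} (C : CartanMatrix r) X {x} → Scaled c X x → ∀ a → pairℚ C x a ≡ c ℚ.* toℚ (pairℤ C X a)
    pair-scaled C X p a = sumℚ-scaled (λ i → sumℚ-scaled (λ j →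
      trans (cong (ℚ._* toℚ (C i j * a j)) (p i)) (trans (scaled-* (X i) (C i j * a j))
        (cong (λ t → c ℚ.* toℚ t) (sym (*-assoc (X i) (C i j) (a j)))))))

    simple-scaled : ∀ {r} (C : CartanMatrix r) i X {x} → Scaled c X x → Scaled c (sRefR (C ᵀ) i X) (sRefV C i x)
    simple-scaled C i X p k with k ≟ i
    ... | yes _ = trans (cong₂ ℚ._-_ (p k) (trans (pair-scaled C X p (unitℤ i)) (cong (λ t → c ℚ.* toℚ t) (sym (pair-ᵀ C (unitℤ i) X)))))
                    (scaled-- (X k) (pairℤ (C ᵀ) (unitℤ i) X))
    ... | no  _ = trans (cong₂ ℚ._-_ (p k) (sym (ℚ.*-zeroʳ c))) (scaled-- (X k) (+ 0))

    act-scaled : ∀ {r} (C : CartanMatrix r) w X {x} → Scaled c X x → Scaled c (actR (C ᵀ) w X) (actV C w x)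
    act-scaled C [] X p = p
    act-scaled C (i ∷ w) X p = simple-scaled C i (actR (C ᵀ) w X) (act-scaled C w X p)

    module _ {N : ℤ} (cN : c ℚ.* toℚ N ≡ 1ℚ) where

      toℚ-scaled : ∀ z → toℚ z ≡ c ℚ.* toℚ (N * z)
      toℚ-scaled z = trans (sym (ℚ.*-identityˡ (toℚ z))) (trans (cong (ℚ._* toℚ z) (sym cN)) (scaled-* N z))

    module _ (c>0 : 0ℚ ℚ.< c) where

      scaled-mono-< : ∀ {x y} → x < y → c ℚ.* toℚ x ℚ.< c ℚ.* toℚ y
      scaled-mono-< p = ℚ.*-monoʳ-<-pos c {{ℚ.positive c>0}} (toℚ-mono-< p)

      scaled-cancel-< : ∀ {x y} → c ℚ.* toℚ x ℚ.< c ℚ.* toℚ y → x < y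
      scaled-cancel-< p = toℚ-cancel-< (ℚ.*-cancelˡ-<-nonNeg c {{ℚ.nonNegative (ℚ.<⇒≤ c>0)}} p)

  common-denominator : ∀ {r} (x : Vecℚ r) → Σ ℤ λ N → (+ 0 < N) × Σ (Vecℤ r) λ X → ∀ k → toℚ N ℚ.* x k ≡ toℚ (X k)
  common-denominator {zero} x = + 1 , +<+ (ℕ.s≤s ℕ.z≤n) , (λ ()) , λ ()
  common-denominator {suc r} x with denominator (x zero) | common-denominator (x ∘ suc)
  ... | d , d>0 , n , eq | N , N>0 , X , eqs = d * N , 0<-* d>0 N>0 , cons (N * n) (d ⊙ X) ,
    λ { zero → trans (cong (λ t → toℚ t ℚ.* x zero) (*-comm d N)) (step N d (x zero) n eq)
      ; (suc k) → step d N (x (suc k)) (X k) (eqs k) }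
    where
    step : ∀ a b q m → toℚ b ℚ.* q ≡ toℚ m → toℚ (a * b) ℚ.* q ≡ toℚ (a * m)
    step a b q m e = trans (cong (ℚ._* q) (toℚ-* a b)) (trans (ℚ.*-assoc (toℚ a) (toℚ b) q)
      (trans (cong (toℚ a ℚ.*_) e) (sym (toℚ-* a m))))

  scaled-representation : ∀ {r} (x : Vecℚ r) → Σ ℚ λ c → Σ (Vecℤ r) λ X → Scaled c X x
  scaled-representation x = let N , N>0 , X , eq = common-denominator x ; c , _ , cN = reciprocal N>0 in
    c , X , λ k → trans (sym (ℚ.*-identityˡ (x k))) (trans (cong (ℚ._* x k) (sym cN))
      (trans (ℚ.*-assoc c (toℚ N) (x k)) (cong (c ℚ.*_) (eq k))))

  module _ {r} (C : CartanMatrix r) (H : IsIrreducibleFiniteCartan C) where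
    open RootSystem C H
    open Stabilizer C H
    open IsIrreducibleFiniteCartan H using (d)

    -- Words are compared on the root lattice, whereas `InGen` compares them on `V`. The
    -- identification `dual` transfers the equality on each `d_j α_j^∨`, and the positive factor
    -- `d_j` cancels.
    ≈-dual : ∀ {u v} → u ≈ v → ∀ X → actR (C ᵀ) u X ≐ actR (C ᵀ) v X
    ≈-dual {u} {v} p X k = linear-ext (L u) (L v) (λ j → *-cancelˡ-pos (d>0 j)
      (trans (on-simple u j) (trans (cong (_* + d k) (p (α j) k)) (sym (on-simple v j))))) X
      where
      L : ∀ w → Linear (λ X → actR (C ᵀ) w X k)
      L w = Action.act-linear (C ᵀ) (coord-linear k) w
      on-simple : ∀ w j → + d j * actR (C ᵀ) w (α j) k ≡ actR C w (α j) k * + d k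
      on-simple w j = trans (sym (scl (L w) (+ d j) (α j))) (trans (sym (resp-≐ (L w) (dual-unit j))) (sym (dual-act w (α j) k)))

    ≈⇒actV : ∀ {u v} → u ≈ v → ∀ x → actV C u x ≐ actV C v x
    ≈⇒actV {u} {v} p x k = let c , X , s = scaled-representation x in
      trans (act-scaled c C u X s k) (trans (cong (λ t → c ℚ.* toℚ t) (≈-dual {u} {v} p X k)) (sym (act-scaled c C v X s k)))

    actV⇒dual : ∀ {u v} → (∀ x → actV C u x ≐ actV C v x) → ∀ X → actR (C ᵀ) u X ≐ actR (C ᵀ) v X
    actV⇒dual {u} {v} p X k = toℚ-injective (trans (sym (ℚ.*-identityˡ _)) (trans (sym (act-scaled 1ℚ C u X s k))
      (trans (p (toℚ ∘ X) k) (trans (act-scaled 1ℚ C v X s k) (ℚ.*-identityˡ _)))))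
      where
      s : Scaled 1ℚ X (toℚ ∘ X)
      s k = sym (ℚ.*-identityˡ (toℚ (X k)))

    gen⇒InGen : ∀ {R u} → Gen R u → InGen C R u
    gen⇒InGen {u = u} (gs , all , eq) = gs , all , ≈⇒actV {u} {product gs} eq

  -- Heights under the affine element w̃_p

  module Anderson {r} (C : CartanMatrix r) (H : IsIrreducibleFiniteCartan C)
                  (θ : Vecℤ r) (hθ : IsHighestRoot C θ) (h : ℕ) (h-eq : + h ≡ + 1 + height θ)
                  (p : ℕ) (p>0 : + 0 < + p) (cop : Coprime p h) where
    open RootSystem C H
    open IsIrreducibleFiniteCartan H using (diag)
    open Action C
    open Involutive diag
    open Stabilizer C H
    open Alcove θ hθ h h-eq p p>0 cop
    private
      module A∨ = Action (C ᵀ)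
      module I∨ = A∨.Involutive diag

    simple-height : ∀ i → height (sRefR C i (α i)) ≡ - + 1
    simple-height i = trans (sum-cong (simple-unit i)) (trans (linear-neg height-linear (α i)) (cong -_ (height-unit i)))

    -- The affine form of `simple-permutes`, with positivity of an affine root read off its height.
    -- `s_i` keeps the constant `m`, whose sign decides unless it is zero.
    affine-simple-permutes : ∀ i {γ} → IsRoot C γ → ∀ m → + 0 < height γ + m * + h →
      ¬ ((γ ≐ α i) × m ≡ + 0) → + 0 < height (sRefR C i γ) + m * + h
    affine-simple-permutes i {γ} R m pos γ≢α with <-cmp m (+ 0)
    ... | tri> _ _ m>0 = affine-height-positive (root-act (i ∷ []) R) m m>0
    ... | tri< m<0 _ _ = ⊥-elim (<-asym pos (subst (_< + 0) (trans (cong (λ t → - (t + - m * + h)) (linear-neg height-linear γ)) (lem (height γ) m (+ h)))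
            (neg-mono-< (affine-height-positive (root-neg R) (- m) (neg-mono-< m<0)))))
      where
      lem : ∀ b m h → - (- b + - m * h) ≡ b + m * h
      lem = solve-∀
    ... | tri≈ _ refl _ with root-sign R
    ...   | inj₂ nonpos = ⊥-elim (<⇒≱ (subst (+ 0 <_) (+-identityʳ (height γ)) pos) (sum-nonpos nonpos))
    ...   | inj₁ nonneg with simple-permutes i R nonneg
    ...     | inj₁ nonneg′ = subst (+ 0 <_) (sym (+-identityʳ _)) (root-height-pos (root-act (i ∷ []) R) nonneg′)
    ...     | inj₂ γ≐α = ⊥-elim (γ≢α (γ≐α , refl))

    module Sommers (a b : ℕ) (p-eq : + p ≡ + a * + h + + b) (h∸b : + (h ℕ.∸ b) ≡ + h - + b)
                   (wp : List (Fin r)) (μp : Vecℤ r) (isWp : IsWp C θ h p a b (wp , μp)) where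

      -- Points of V are written as c (w_p⁻¹ X - N μ_p) with X integral and c = 1/N, so that w̃_p maps them to c X.
      module Scale (N : ℤ) (c : ℚ) (c>0 : 0ℚ ℚ.< c) (cN : c ℚ.* toℚ N ≡ 1ℚ) where

        preimage : Vecℤ r → Vecℤ r
        preimage X = actR (C ᵀ) (reverse wp) X ⊕ (- N) ⊙ μp

        point : Vecℤ r → Vecℚ r
        point X k = c ℚ.* toℚ (preimage X k)

        -- This is `N` times the value of the affine root `γ + k δ` at `point X`.
        value : Vecℤ r → Vecℤ r → ℤ → ℤ
        value X γ k = pairℤ C X (actR C wp γ) - N * pairℤ C μp γ + N * k

        image-point : ∀ X → Scaled c X (actPt C (wp , μp) (point X))
        image-point X k = trans (act-scaled c C wp (actR (C ᵀ) (reverse wp) X) translate k)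
          (cong (λ t → c ℚ.* toℚ t) (I∨.act-reverse′ wp X k))
          where
          lem : ∀ y N m → y + - N * m + N * m ≡ y
          lem = solve-∀
          translate : Scaled c (actR (C ᵀ) (reverse wp) X) (λ l → point X l ℚ.+ toℚ (μp l))
          translate l = trans (cong (point X l ℚ.+_) (toℚ-scaled c {N} cN (μp l)))
            (trans (scaled-+ c (preimage X l) (N * μp l))
              (cong (λ t → c ℚ.* toℚ t) (lem (actR (C ᵀ) (reverse wp) X l) N (μp l))))

        pair-point : ∀ X γ → pairℚ C (point X) γ ≡ c ℚ.* toℚ (pairℤ C X (actR C wp γ) - N * pairℤ C μp γ)
        pair-point X γ = trans (pair-scaled c C (preimage X) (λ _ → refl) γ)
          (cong (λ t → c ℚ.* toℚ t) (trans (linear-sub (pair-linearˡ C γ) (actR (C ᵀ) (reverse wp) X) N μp)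
            (cong (_- N * pairℤ C μp γ) (trans (pair-act C (reverse wp) X γ)
              (cong (λ w → pairℤ C X (actR C w γ)) (List.reverse-involutive wp))))))

        value-neg : ∀ X γ k → value X (negV γ) k ≡ N * k - (pairℤ C X (actR C wp γ) - N * pairℤ C μp γ)
        value-neg X γ k = trans (cong₂ (λ x y → x - N * y + N * k)
            (linear-neg (act-linear (pair-linearʳ C X) wp) γ) (linear-neg (pair-linearʳ C μp) γ))
          (lem (pairℤ C X (actR C wp γ)) N (pairℤ C μp γ) k)
          where
          lem : ∀ x N y k → - x - N * - y + N * k ≡ N * k - (x - N * y)
          lem = solve-∀

        value-pos : ∀ X γ k → value X γ k ≡ (pairℤ C X (actR C wp γ) - N * pairℤ C μp γ) - N * - k
        value-pos X γ k = lem (pairℤ C X (actR C wp γ) - N * pairℤ C μp γ) N k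
          where
          lem : ∀ x N k → x + N * k ≡ x - N * - k
          lem = solve-∀

        -- The inequalities of `InS`, rewritten as positivity of affine roots of height `p`:
        -- `γ + a δ` with `γ` of height `b`, and `- γ + (a + 1) δ` with `γ` of height `h - b`.
        PositiveValues : Vecℤ r → Set
        PositiveValues X =
          (∀ γ → IsRoot C γ → height γ ≡ + b → + 0 < value X γ (+ a)) ×
          (∀ γ → IsRoot C γ → height γ ≡ + (h ℕ.∸ b) → + 0 < value X (negV γ) (+ (a ℕ.+ 1)))

        inS⇒values : ∀ X → InS C h a b (point X) → PositiveValues X
        inS⇒values X (lower , upper) =
          (λ γ R ht → subst (+ 0 <_) (sym (value-pos X γ (+ a))) (0<-diff (scaled-cancel-< c c>0 {N * - + a} {pairℤ C X (actR C wp γ) - N * pairℤ C μp γ}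
            (subst₂ ℚ._<_ (toℚ-scaled c {N} cN (- + a)) (pair-point X γ) (lower γ R ht))))) ,
          (λ γ R ht → subst (+ 0 <_) (sym (value-neg X γ (+ (a ℕ.+ 1)))) (0<-diff (scaled-cancel-< c c>0 {pairℤ C X (actR C wp γ) - N * pairℤ C μp γ} {N * + (a ℕ.+ 1)}
            (subst₂ ℚ._<_ (pair-point X γ) (toℚ-scaled c {N} cN (+ (a ℕ.+ 1))) (upper γ R ht)))))

        values⇒inS : ∀ X → PositiveValues X → InS C h a b (point X)
        values⇒inS X (lower , upper) =
          (λ γ R ht → subst₂ ℚ._<_ (sym (toℚ-scaled c {N} cN (- + a))) (sym (pair-point X γ))
            (scaled-mono-< c c>0 {N * - + a} {pairℤ C X (actR C wp γ) - N * pairℤ C μp γ} (<-by (lower γ R ht) (value-pos X γ (+ a))))) ,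
          (λ γ R ht → subst₂ ℚ._<_ (sym (pair-point X γ)) (sym (toℚ-scaled c {N} cN (+ (a ℕ.+ 1))))
            (scaled-mono-< c c>0 {pairℤ C X (actR C wp γ) - N * pairℤ C μp γ} {N * + (a ℕ.+ 1)} (<-by (upper γ R ht) (value-neg X γ (+ (a ℕ.+ 1))))))

        alcove⇒values : ∀ X → (∀ i → + 0 < pairℤ C X (α i)) → pairℤ C X θ < N * + p → PositiveValues X
        alcove⇒values X X-dom X-θ = inS⇒values X (proj₂ (isWp (point X))
          ((λ i → subst₂ ℚ._<_ (ℚ.*-zeroʳ c) (sym (pair-scaled c C X (image-point X) (α i))) (scaled-mono-< c c>0 (X-dom i))) ,
           subst₂ ℚ._<_ (sym (pair-scaled c C X (image-point X) θ)) (sym (toℚ-scaled c {N} cN (+ p))) (scaled-mono-< c c>0 X-θ)))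

        values⇒alcove : ∀ X → PositiveValues X → ∀ i → + 0 < pairℤ C X (α i)
        values⇒alcove X vals i = scaled-cancel-< c c>0 (subst₂ ℚ._<_ (sym (ℚ.*-zeroʳ c)) (pair-scaled c C X (image-point X) (α i))
          (proj₁ (proj₁ (isWp (point X)) (values⇒inS X vals)) i))

      -- `w̃_p` sends `γ + ⟨μ_p, γ⟩ δ` to `w_p γ`, so this is the height of the preimage of `w_p γ`
      -- under `w̃_p`.
      preimage-height : Vecℤ r → ℤ
      preimage-height γ = affHeight h (γ , pairℤ C μp γ)

      preimage-height-linear : Linear preimage-height
      preimage-height-linear = linear-≗ (λ γ → lem (height γ) (pairℤ C μp γ) (+ h))
        (linear-comb height-linear (pair-linearʳ C μp) (+ 1) (+ h))
        where
        lem : ∀ x y h → x + y * h ≡ + 1 * x + h * y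
        lem = solve-∀

      -- If w̃_p⁻¹(αᵢ) had another height than p, then the facet ⟨x, αᵢ⟩ = 0 of p A∘ would contain a point of
      -- w̃_p(S): the midpoint of a small multiple of ρ^∨ and of its reflection.
      simple-affine-height : ∀ i → preimage-height (actR C (reverse wp) (α i)) ≡ + p
      simple-affine-height i with preimage-height (actR C (reverse wp) (α i)) Data.Integer.≟ + p
      ... | yes eq = eq
      ... | no not-p = ⊥-elim (<-irrefl (sym on-facet) (values⇒alcove X₂ (lower , upper) i))
        where
        dom : Σ (Vecℤ r) λ z → Σ ℤ λ K → (+ 0 < K) × (∀ j → B z (α j) ≡ K * + 1)
        dom = dominant-vector (λ _ → + 1)
        K : ℤ
        K = proj₁ (proj₂ dom)
        K>0 : + 0 < K
        K>0 = proj₁ (proj₂ (proj₂ dom))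
        ρ : Vecℤ r
        ρ = dual (proj₁ dom)
        pair-ρ : ∀ γ → pairℤ C ρ γ ≡ K * height γ
        pair-ρ = linear-ext (pair-linearʳ C ρ) (linear-scale height-linear K)
          (λ j → trans (proj₂ (proj₂ (proj₂ dom)) j) (cong (K *_) (sym (height-unit j))))
        -- As `ρ` is `K ρ^∨`, over this denominator `X₁` stands for `ρ^∨ / h`, where an affine root
        -- takes its height divided by `h` as value, and `X₂` for the midpoint of that point and its
        -- image under `s_i`. The factor 2 keeps the midpoint integral.
        N : ℤ
        N = + 2 * K * + h
        2K>0 : + 0 < + 2 * K
        2K>0 = 0<-* {+ 2} (+<+ (ℕ.s≤s ℕ.z≤n)) K>0
        rec : Σ ℚ λ c → (0ℚ ℚ.< c) × (c ℚ.* toℚ N ≡ 1ℚ)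
        rec = reciprocal (0<-* 2K>0 h>0)
        open Scale N (proj₁ rec) (proj₁ (proj₂ rec)) (proj₂ (proj₂ rec))
        X₁ X₂ : Vecℤ r
        X₁ = + 2 ⊙ ρ
        X₂ = ρ ⊕ actR (C ᵀ) (i ∷ []) ρ
        pair-X₁ : ∀ γ → pairℤ C X₁ γ ≡ + 2 * (K * height γ)
        pair-X₁ γ = trans (scl (pair-linearˡ C γ) (+ 2) ρ) (cong (+ 2 *_) (pair-ρ γ))
        pair-X₂ : ∀ γ → pairℤ C X₂ γ ≡ K * (height γ + height (sRefR C i γ))
        pair-X₂ γ = trans (add (pair-linearˡ C γ) ρ (actR (C ᵀ) (i ∷ []) ρ))
          (trans (cong₂ _+_ (pair-ρ γ) (trans (pair-act C (i ∷ []) ρ γ) (pair-ρ (sRefR C i γ))))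
            (sym (*-distribˡ-+ K (height γ) (height (sRefR C i γ)))))
        on-facet : pairℤ C X₂ (α i) ≡ + 0
        on-facet = trans (pair-X₂ (α i)) (trans (cong (K *_) (cong₂ _+_ (height-unit i) (simple-height i))) (*-zeroʳ K))
        values₁ : PositiveValues X₁
        values₁ = alcove⇒values X₁
          (λ j → subst (+ 0 <_) (sym (trans (pair-X₁ (α j)) (cong (λ t → + 2 * (K * t)) (height-unit j))))
            (subst (+ 0 <_) (cong (+ 2 *_) (sym (*-identityʳ K))) 2K>0))
          (<-by (0<-* 2K>0 (+-mono-<-≤ {+ 0} (root-height-< (proj₁ hθ)) (0≤-* (<⇒≤ h>0) (0≤-diff (0<⇒1≤ p>0)))))
            (trans (lem K (+ h) (height θ) (+ p)) (cong (λ t → N * + p - t) (sym (pair-X₁ θ)))))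
          where
          lem : ∀ K h t p → + 2 * K * (h - t + h * (p - + 1)) ≡ + 2 * K * h * p - + 2 * (K * t)
          lem = solve-∀
        -- `w̃_p` sends `γ + k δ` to the affine root with gradient `actR C wp γ` and constant `m`.
        -- Positivity at `X₁` says that its height is positive; at `X₂` the height of its reflection
        -- is added. That one is positive too unless the affine root is `α_i`, which `not-p` rules
        -- out.
        transfer : ∀ {γ} k → IsRoot C γ → height γ + k * + h ≡ + p → + 0 < value X₁ γ k → + 0 < value X₂ γ k
        transfer {γ} k R ht v₁ = subst (+ 0 <_) (sym value₂)
          (0<-* K>0 (+-mono-<-≤ pos₁ (<⇒≤ (affine-simple-permutes i (root-act wp R) m pos₁ excluded))))
          where
          δ : Vecℤ r
          δ = actR C wp γ
          m : ℤ
          m = k - pairℤ C μp γ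
          value₁ : value X₁ γ k ≡ + 2 * K * (height δ + m * + h)
          value₁ = trans (cong (λ t → t - N * pairℤ C μp γ + N * k) (pair-X₁ δ)) (lem K (height δ) (+ h) (pairℤ C μp γ) k)
            where
            lem : ∀ K t h y k → + 2 * (K * t) - + 2 * K * h * y + + 2 * K * h * k ≡ + 2 * K * (t + (k - y) * h)
            lem = solve-∀
          value₂ : value X₂ γ k ≡ K * ((height δ + m * + h) + (height (sRefR C i δ) + m * + h))
          value₂ = trans (cong (λ t → t - N * pairℤ C μp γ + N * k) (pair-X₂ δ))
            (lem K (height δ) (height (sRefR C i δ)) (+ h) (pairℤ C μp γ) k)
            where
            lem : ∀ K t s h y k → K * (t + s) - + 2 * K * h * y + + 2 * K * h * k ≡ K * ((t + (k - y) * h) + (s + (k - y) * h))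
            lem = solve-∀
          pos₁ : + 0 < height δ + m * + h
          pos₁ = 0<-cancel-* 2K>0 (subst (+ 0 <_) value₁ v₁)
          excluded : ¬ ((δ ≐ α i) × m ≡ + 0)
          excluded (δ≐α , m≡0) = not-p (trans (resp-≐ preimage-height-linear {actR C (reverse wp) (α i)} {γ}
              (λ l → trans (sym (act-cong (reverse wp) δ≐α l)) (act-reverse wp γ l)))
            (trans (cong (λ t → height γ + t * + h) (sym (i-j≡0⇒i≡j k (pairℤ C μp γ) m≡0))) ht))
        lower : ∀ γ → IsRoot C γ → height γ ≡ + b → + 0 < value X₂ γ (+ a)
        lower γ R ht = transfer (+ a) R (trans (cong (_+ + a * + h) ht) (trans (+-comm (+ b) (+ a * + h)) (sym p-eq)))
          (proj₁ values₁ γ R ht)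
        upper : ∀ γ → IsRoot C γ → height γ ≡ + (h ℕ.∸ b) → + 0 < value X₂ (negV γ) (+ (a ℕ.+ 1))
        upper γ R ht = transfer {negV γ} (+ (a ℕ.+ 1)) (root-neg R)
          (trans (cong₂ (λ x y → x + y * + h) (trans (linear-neg height-linear γ) (cong -_ (trans ht h∸b))) (pos-+ a 1))
            (trans (lem (+ h) (+ b) (+ a)) (sym p-eq)))
          (proj₂ values₁ γ R ht)
          where
          lem : ∀ h b a → - (h - b) + (a + + 1) * h ≡ a * h + b
          lem = solve-∀

      -- Linearity spreads the result from the simple roots, and settles the last wall as well: the
      -- preimage of `- θ + p δ` has height `p (h - ht θ) = p`.
      affine-height-image : ∀ γ → preimage-height γ ≡ + p * height (actR C wp γ)
      affine-height-image γ = trans (sym (resp-≐ preimage-height-linear (act-reverse wp γ)))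
        (linear-ext (act-linear preimage-height-linear (reverse wp)) (linear-scale height-linear (+ p))
          (λ i → trans (simple-affine-height i) (sym (trans (cong (+ p *_) (height-unit i)) (*-identityʳ (+ p)))))
          (actR C wp γ))

      affine-height-preimage : ∀ γ → preimage-height (actR C (reverse wp) γ) ≡ + p * height γ
      affine-height-preimage γ = trans (affine-height-image (actR C (reverse wp) γ))
        (cong (+ p *_) (sum-cong (act-reverse′ wp γ)))

  -- The stabilizer of 𝒜(w̃)

  pos-< : ∀ {p} → 0 ℕ.< p → + 0 < + p
  pos-< = +<+

  pos-*+ : ∀ {p} a h b → p ≡ a ℕ.* h ℕ.+ b → + p ≡ + a * + h + + b
  pos-*+ a h b refl = trans (pos-+ (a ℕ.* h) b) (cong (_+ + b) (pos-* a h))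

  pos-∸ : ∀ {b h} → b ℕ.< h → + (h ℕ.∸ b) ≡ + h - + b
  pos-∸ {b} {h} b<h = sym (trans (m-n≡m⊖n h b) (⊖-≥ (ℕ.<⇒≤ b<h)))

  -- Conjugation of subgroups generated by reflections

  module Conjugation {r} (C : CartanMatrix r) (H : IsIrreducibleFiniteCartan C) where
    open RootSystem C H
    open IsIrreducibleFiniteCartan H using (diag)
    open Action C
    open Involutive diag
    open Stabilizer C H

    gen-≈ : ∀ {R u v} → u ≈ v → Gen R u → Gen R v
    gen-≈ p (gs , all , eq) = gs , all , λ a k → trans (sym (p a k)) (eq a k)

    act-conjugate : ∀ τ u a → actR C (τ ++ u ++ reverse τ) a ≐ actR C τ (actR C u (actR C (reverse τ) a))
    act-conjugate τ u a k = cong (λ x → x k) (trans (act-++ τ (u ++ reverse τ) a) (cong (actR C τ) (act-++ u (reverse τ) a)))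

    act-conjugate-++ : ∀ τ u v a →
      actR C (τ ++ (u ++ v) ++ reverse τ) a ≐ actR C (τ ++ u ++ reverse τ) (actR C (τ ++ v ++ reverse τ) a)
    act-conjugate-++ τ u v a k = trans (act-conjugate τ (u ++ v) a k)
      (trans (act-cong τ {b = actR C u (actR C (reverse τ) (actR C (τ ++ v ++ reverse τ) a))} (λ l →
          trans (cong (λ x → x l) (act-++ u v (actR C (reverse τ) a)))
          (act-cong u (λ m → sym (trans (act-cong (reverse τ) (act-conjugate τ v a) m) (act-reverse τ _ m))) l)) k)
        (sym (act-conjugate τ u _ k)))

    reflWord-++ : ∀ (τ v : List (Fin r)) i → reflWord (τ ++ v) i ≡ τ ++ reflWord v i ++ reverse τ
    reflWord-++ τ v i = trans (cong (λ w → (τ ++ v) ++ i ∷ w) (List.reverse-++ τ v))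
      (trans (List.++-assoc τ v (i ∷ reverse v ++ reverse τ)) (cong (τ ++_) (sym (List.++-assoc v (i ∷ reverse v) (reverse τ)))))

    -- Conjugating by `τ` turns `s_β` into `s_{τ β}`, already at the level of words by
    -- `reflWord-++`.
    gen-conjugate : ∀ {R R′} τ → (∀ v i → R (actR C v (α i)) → R′ (actR C (τ ++ v) (α i))) →
      ∀ {u} → Gen R u → Gen R′ (τ ++ u ++ reverse τ)
    gen-conjugate {R} {R′} τ R⇒R′ {u} (gs , all , eq) = gen-≈ {R′} {τ ++ product gs ++ reverse τ} {τ ++ u ++ reverse τ}
        (λ a k → trans (act-conjugate τ (product gs) a k)
          (trans (act-cong τ (λ l → sym (eq (actR C (reverse τ) a) l)) k) (sym (act-conjugate τ u a k))))
        (conjugate-product gs all)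
      where
      conjugate-product : ∀ gs → All (λ g → R (actR C (proj₁ g) (α (proj₂ g)))) gs → Gen R′ (τ ++ product gs ++ reverse τ)
      conjugate-product [] [] = gen-nil {R′} {τ ++ reverse τ}
        (λ a k → trans (cong (λ x → x k) (act-++ τ (reverse τ) a)) (act-reverse′ τ a k))
      conjugate-product ((v , i) ∷ gs) (Rv ∷ all) with conjugate-product gs all
      ... | hs , all′ , eq′ = (τ ++ v , i) ∷ hs , R⇒R′ v i Rv ∷ all′ , λ a k →
        trans (act-conjugate-++ τ (reflWord v i) (product gs) a k)
        (trans (cong (λ w → actR C w (actR C (τ ++ product gs ++ reverse τ) a) k) (sym (reflWord-++ τ v i)))
        (trans (act-cong (reflWord (τ ++ v) i) (eq′ a) k)
          (cong (λ x → x k) (sym (act-++ (reflWord (τ ++ v) i) (product hs) a)))))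

  module AndersonStabilizer {r} (C : CartanMatrix r) (H : IsIrreducibleFiniteCartan C)
              (θ : Vecℤ r) (hθ : IsHighestRoot C θ) (h : ℕ) (h-eq : + h ≡ + 1 + height θ)
              (p : ℕ) (p>0 : + 0 < + p) (cop : Coprime p h)
              (a b : ℕ) (p-eq : + p ≡ + a * + h + + b) (h∸b : + (h ℕ.∸ b) ≡ + h - + b)
              (wp : List (Fin r)) (μp : Vecℤ r) (isWp : IsWp C θ h p a b (wp , μp))
              (w : List (Fin r)) (μ : Vecℤ r) (inWp : InWp C h p (w , μ)) where
    open RootSystem C H
    open IsIrreducibleFiniteCartan H using (diag)
    open Action C
    open Involutive diag
    open Stabilizer C H
    open Alcove θ hθ h h-eq p p>0 cop
    open Anderson C H θ hθ h h-eq p p>0 cop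
    open Sommers a b p-eq h∸b wp μp isWp
    open Conjugation C H
    private
      module A∨ = Action (C ᵀ)
      module I∨ = A∨.Involutive diag

    -- 𝒜(w̃) = V = w y₀, and y = w̃_p w̃⁻¹ · 0 = - τ⁻¹ V for the linear part τ of w̃ w̃_p⁻¹.
    y₀ V y : Vecℤ r
    y₀ = μ ⊕ (- + 1) ⊙ μp
    V = actR (C ᵀ) w y₀
    y = negV (actR (C ᵀ) wp y₀)

    τ : List (Fin r)
    τ = w ++ reverse wp

    pair-y₀ : ∀ γ → pairℤ C y₀ γ ≡ pairℤ C μ γ - pairℤ C μp γ
    pair-y₀ γ = trans (linear-sub (pair-linearˡ C γ) μ (+ 1) μp)
      (cong (λ t → pairℤ C μ γ - t) (*-identityˡ (pairℤ C μp γ)))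

    pair-y : ∀ γ → pairℤ C y γ ≡ - pairℤ C y₀ (actR C (reverse wp) γ)
    pair-y γ = trans (linear-neg (pair-linearˡ C γ) (actR (C ᵀ) wp y₀)) (cong -_ (pair-act C wp y₀ γ))

    -- The left side is the constant term of the image of `γ + k p δ` under `w̃ w̃_p⁻¹`, that is,
    -- the value of that image at `0`; it equals the value of `γ + k p δ` at the preimage `y` of
    -- `0`.
    lift-constant : ∀ γ k →
      k * + p + pairℤ C μp (actR C (reverse wp) γ) - pairℤ C μ (actR C (reverse wp) γ) ≡ pairℤ C y γ + k * + p
    lift-constant γ k = trans (lem (k * + p) (pairℤ C μp δ) (pairℤ C μ δ))
      (cong (_+ k * + p) (sym (trans (pair-y γ) (cong -_ (pair-y₀ δ)))))
      where
      δ : Vecℤ r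
      δ = actR C (reverse wp) γ
      lem : ∀ k x y → k + x - y ≡ - (y - x) + k
      lem = solve-∀

    -- w̃_p⁻¹ maps γ + kpδ to an affine root of height p (ht γ + kh).
    lift : ∀ {γ} → IsRoot C γ → ∀ k → height γ + k * + h ≡ + 1 →
      InΦ̃ C h p (actR C (reverse wp) γ , k * + p + pairℤ C μp (actR C (reverse wp) γ))
    lift {γ} R k ht = root-act (reverse wp) R ,
      trans (lem (height δ) k (+ p) (pairℤ C μp δ) (+ h))
        (trans (cong (_+ k * + p * + h) (affine-height-preimage γ))
          (trans (lem′ (+ p) (height γ) k (+ h)) (trans (cong (+ p *_) ht) (*-identityʳ (+ p)))))
      where
      δ : Vecℤ r
      δ = actR C (reverse wp) γ
      lem : ∀ t k p y h → t + (k * p + y) * h ≡ t + y * h + k * p * h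
      lem = solve-∀
      lem′ : ∀ p t k h → p * t + k * p * h ≡ p * (t + k * h)
      lem′ = solve-∀

    -- By `inWp` the image under `w̃` is a positive affine root, and both kinds of these have a
    -- nonnegative constant term. Over all walls this puts `y` in the closed alcove.
    wall-nonneg : ∀ {γ} → IsRoot C γ → ∀ k → height γ + k * + h ≡ + 1 → + 0 ≤ pairℤ C y γ + k * + p
    wall-nonneg {γ} R k ht with inWp (actR C (reverse wp) γ , k * + p + pairℤ C μp (actR C (reverse wp) γ)) (lift R k ht)
    ... | inj₁ (_ , le) = subst (+ 0 ≤_) (lift-constant γ k) le
    ... | inj₂ (_ , lt) = subst (+ 0 ≤_) (lift-constant γ k) (<⇒≤ lt)

    y-dom : ∀ i → + 0 ≤ pairℤ C y (α i)
    y-dom i = subst (+ 0 ≤_) (+-identityʳ (pairℤ C y (α i)))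
      (wall-nonneg (root-simple i) (+ 0) (trans (+-identityʳ (height (α i))) (height-unit i)))

    y-θ : pairℤ C y θ ≤ + p
    y-θ = ≤-by (wall-nonneg (root-neg (proj₁ hθ)) (+ 1)
        (trans (cong₂ (λ s t → s + + 1 * t) (linear-neg height-linear θ) h-eq) (lem (height θ))))
      (trans (cong (_+ + 1 * + p) (linear-neg (pair-linearʳ C y) θ)) (lem′ (pairℤ C y θ) (+ p)))
      where
      lem : ∀ t → - t + + 1 * (+ 1 + t) ≡ + 1
      lem = solve-∀
      lem′ : ∀ y p → - y + + 1 * p ≡ p - y
      lem′ = solve-∀

    open Point y y-dom y-θ

    τy : actR (C ᵀ) τ y ≐ negV V
    τy k = trans (cong (λ x → x k) (A∨.act-++ w (reverse wp) y))
      (trans (A∨.act-cong w (λ l → trans (A∨.act-neg (reverse wp) (actR (C ᵀ) wp y₀) l) (cong -_ (I∨.act-reverse wp y₀ l))) k)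
        (A∨.act-neg w y₀ k))

    stab-transport : ∀ u → Stab (+ p) V u → Stab (+ p) y (reverse τ ++ u ++ τ)
    stab-transport u (ν , eq) = negV (actR (C ᵀ) (reverse τ) ν) , λ k →
      trans (cong (λ x → x k) (trans (A∨.act-++ (reverse τ) (u ++ τ) y) (cong (actR (C ᵀ) (reverse τ)) (A∨.act-++ u τ y))))
      (trans (A∨.act-cong (reverse τ) (moved) k)
      (trans (add (L k) (actR (C ᵀ) τ y) (- + p ⊙ ν))
      (trans (cong₂ _+_ (I∨.act-reverse τ y k) (scl (L k) (- + p) ν)) (lem (y k) (+ p) (actR (C ᵀ) (reverse τ) ν k)))))
      where
      L : ∀ k → Linear (λ X → actR (C ᵀ) (reverse τ) X k)
      L k = A∨.act-linear (coord-linear k) (reverse τ)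
      moved : actR (C ᵀ) u (actR (C ᵀ) τ y) ≐ (actR (C ᵀ) τ y ⊕ - + p ⊙ ν)
      moved l = trans (A∨.act-cong u τy l) (trans (A∨.act-neg u V l) (trans (cong -_ (eq l))
        (trans (lem₁ (V l) (+ p) (ν l)) (cong (_+ - + p * ν l) (sym (τy l))))))
        where
        lem₁ : ∀ v p n → - (v + p * n) ≡ - v + - p * n
        lem₁ = solve-∀
      lem : ∀ y p n → y + - p * n ≡ y + p * - n
      lem = solve-∀

    -- The wall passes through `y` precisely when the constant term of its image vanishes, which
    -- makes the image an element of `Φ`.
    wall⇒refSet : ∀ v i → Wall y (actR C v (α i)) → RefSet C h p (w , μ) (actR C (τ ++ v) (α i))
    wall⇒refSet v i (R , k , A≡0 , ht) = (actR C (reverse wp) γ , k * + p + pairℤ C μp (actR C (reverse wp) γ)) ,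
      lift R k ht ,
      (λ l → cong (λ x → x l) (sym (trans (act-++ τ v (α i)) (act-++ w (reverse wp) γ)))) ,
      trans (lift-constant γ k) A≡0
      where
      γ : Vecℤ r
      γ = actR C v (α i)

    stab⇒refGen : ∀ u → Stab (+ p) V u → Gen (RefSet C h p (w , μ)) u
    stab⇒refGen u s = gen-≈ {RefSet C h p (w , μ)} {τ ++ u₀ ++ reverse τ} {u} conjugated
      (gen-conjugate {Wall y} {RefSet C h p (w , μ)} τ wall⇒refSet {u₀} (stab⇒gen u₀ (stab-transport u s)))
      where
      u₀ : List (Fin r)
      u₀ = reverse τ ++ u ++ τ
      conjugated : (τ ++ u₀ ++ reverse τ) ≈ u
      conjugated x k = trans (act-conjugate τ u₀ x k)
        (trans (act-cong τ (λ l → cong (λ z → z l) (trans (act-++ (reverse τ) (u ++ τ) (actR C (reverse τ) x))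
            (cong (actR C (reverse τ)) (act-++ u τ (actR C (reverse τ) x))))) k)
        (trans (act-reverse′ τ (actR C u (actR C τ (actR C (reverse τ) x))) k) (act-cong u (act-reverse′ τ x) k)))

    -- Let `x` be the constant term of `w̃_p(γ + k δ)`. The vanishing constant term of `w̃(γ + k δ)`
    -- identifies `x` with the pairing of `V` and `β`, and comparing heights gives
    -- `h x = p (1 - ht (w_p γ))`, so `p` divides `x` by coprimality.
    refSet-divisible : ∀ β → RefSet C h p (w , μ) β → Σ ℤ λ m → pairℤ C V β ≡ + p * m
    refSet-divisible β ((γ , k) , (R , ht) , wγ≐β , k≡) =
      proj₁ quotient , trans pair-V (proj₂ quotient)
      where
      x : ℤ
      x = k - pairℤ C μp γ
      pair-V : pairℤ C V β ≡ x
      pair-V = trans (pair-act C w y₀ β) (trans (resp-≐ (pair-linearʳ C y₀) {actR C (reverse w) β} {γ}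
          (λ l → trans (sym (act-cong (reverse w) wγ≐β l)) (act-reverse w γ l)))
        (trans (pair-y₀ γ) (cong (_- pairℤ C μp γ) (sym (i-j≡0⇒i≡j k (pairℤ C μ γ) k≡)))))
      quotient : Σ ℤ λ m → x ≡ + p * m
      quotient = coprime-divides cop (+ 1 - height (actR C wp γ)) x
        (trans (lem (+ p) (height (actR C wp γ))) (trans (cong₂ _-_ (sym ht) (sym (affine-height-image γ)))
          (lem′ (height γ) k (+ h) (pairℤ C μp γ))))
        where
        lem : ∀ p t → p * (+ 1 - t) ≡ p - p * t
        lem = solve-∀
        lem′ : ∀ t k h y → t + k * h - (t + y * h) ≡ h * (k - y)
        lem′ = solve-∀

    stab-product : ∀ gs → All (λ g → RefSet C h p (w , μ) (actR C (proj₁ g) (α (proj₂ g)))) gs → Stab (+ p) V (product gs)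
    stab-product [] [] = (λ _ → + 0) , λ k → sym (trans (cong (_+_ (V k)) (*-zeroʳ (+ p))) (+-identityʳ (V k)))
    stab-product ((v , i) ∷ gs) (Rv ∷ all) = let m , eq = refSet-divisible (actR C v (α i)) Rv in
      stab-++ (+ p) V (reflWord v i) (product gs) (stab-reflection (+ p) V v i m eq) (stab-product gs all)

    anderson-scaled : Scaled 1ℚ V (anderson C (wp , μp) (w , μ))
    anderson-scaled = act-scaled 1ℚ C w y₀ (λ k → trans
      (cong₂ (λ s t → s ℚ.- t ℚ.+ toℚ (μ k)) (act-scaled 1ℚ C (reverse wp) (λ _ → + 0) (λ _ → refl) k) (sym (ℚ.*-identityˡ (toℚ (μp k)))))
      (trans (cong₂ ℚ._+_ (scaled-- 1ℚ (actR (C ᵀ) (reverse wp) (λ _ → + 0) k) (μp k)) (sym (ℚ.*-identityˡ (toℚ (μ k)))))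
      (trans (scaled-+ 1ℚ (actR (C ᵀ) (reverse wp) (λ _ → + 0) k - μp k) (μ k))
        (cong (λ t → 1ℚ ℚ.* toℚ t) (trans (cong (λ t → t - μp k + μ k) (scl (A∨.act-linear (coord-linear k) (reverse wp)) (+ 0) (λ _ → + 0)))
          (lem (μp k) (μ k)))))))
      where
      lem : ∀ x y → + 0 - x + y ≡ y + - + 1 * x
      lem = solve-∀

    displacement : ∀ u k → actV C u (anderson C (wp , μp) (w , μ)) k ℚ.- anderson C (wp , μp) (w , μ) k ≡
      toℚ (actR (C ᵀ) u V k - V k)
    displacement u k = trans (cong₂ ℚ._-_ (act-scaled 1ℚ C u V anderson-scaled k) (anderson-scaled k))
      (trans (scaled-- 1ℚ (actR (C ᵀ) u V k) (V k)) (ℚ.*-identityˡ (toℚ (actR (C ᵀ) u V k - V k))))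

    inStab⇒stab : ∀ u → InStab C p (anderson C (wp , μp) (w , μ)) u → Stab (+ p) V u
    inStab⇒stab u (ν , eq) = ν , λ k → trans (lem (actR (C ᵀ) u V k) (V k))
      (cong (_+_ (V k)) (toℚ-injective (trans (sym (displacement u k)) (eq k))))
      where
      lem : ∀ x v → x ≡ v + (x - v)
      lem = solve-∀

    stab⇒inStab : ∀ u → Stab (+ p) V u → InStab C p (anderson C (wp , μp) (w , μ)) u
    stab⇒inStab u (ν , eq) = ν , λ k → trans (displacement u k)
      (cong toℚ (trans (cong (_- V k) (eq k)) (lem (V k) (+ p * ν k))))
      where
      lem : ∀ v x → v + x - v ≡ x
      lem = solve-∀

    anderson-stabilizer : ∀ u →
      (InStab C p (anderson C (wp , μp) (w , μ)) u → InGen C (RefSet C h p (w , μ)) u) ×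
      (InGen C (RefSet C h p (w , μ)) u → InStab C p (anderson C (wp , μp) (w , μ)) u)
    anderson-stabilizer u =
      (λ s → gen⇒InGen C H {RefSet C h p (w , μ)} {u} (stab⇒refGen u (inStab⇒stab u s))) ,
      (λ { (gs , all , eq) → let ν , st = stab-product gs all in
        stab⇒inStab u (ν , λ k → trans (actV⇒dual C H {u} {product gs} eq V k) (st k)) })

open import Data.Nat using (ℕ; _+_; _*_; _<_)
open import Data.Nat.Coprimality using (Coprime)
open import Data.Integer using (+_)
open import Data.List using (List)
open import Data.Fin using (Fin)
open import Data.Product using (_×_)
open import Relation.Binary.PropositionalEquality using (_≡_)
open import Data.Product using (_,_)
open Development using (module AndersonStabilizer; pos-<; pos-*+; pos-∸)

theorem8p6 : ∀ {r} (C : CartanMatrix r) → IsIrreducibleFiniteCartan C →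
    (θ : Vecℤ r) → IsHighestRoot C θ →
    (h : ℕ) → + h ≡ + 1 Data.Integer.+ height θ →
    (p : ℕ) → 0 < p → Coprime p h →
    (a b : ℕ) → p ≡ a * h + b → 0 < b → b < h →
    (w̃p : AffW r) → IsWp C θ h p a b w̃p →
    (w̃ : AffW r) → InWp C h p w̃ →
    (u : List (Fin r)) →
    (InStab C p (anderson C w̃p w̃) u → InGen C (RefSet C h p w̃) u) ×
    (InGen C (RefSet C h p w̃) u → InStab C p (anderson C w̃p w̃) u)
theorem8p6 C H θ hθ h h-eq p 0<p cop a b p-eq _ b<h (wp , μp) isWp (w , μ) inWp =
  AndersonStabilizer.anderson-stabilizer C H θ hθ h h-eq p (pos-< 0<p) cop a b (pos-*+ a h b p-eq) (pos-∸ b<h) wp μp isWp w μ inWp
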